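{- Let $n\ge 2$ and $b\ge 2$ be integers and $r\ge 0$. The probability that the base-$b$ carries chain for adding $n$ numbers, started at $\kappa_0=0$, is in state $j$ after $r$ steps equals the probability that a random permutation of $S_n$ with law $Q_{b^r}$ (the law of the permutation obtained by performing $r$ successive independent $b$-shuffles starting from the identity) has exactly $j$ descents. In formulas, for $0\le j\le n-1$, $$P_b^r(0,j)=\sum_{\sigma\in S_n:\ d(\sigma)=j} Q_{b^r}(\sigma).$$
   Context: For $\sigma\in S_n$, $\sigma$ has a descent at $i$ ($1\le i\le n-1$) if $\sigma(i+1)<\sigma(i)$; $d(\sigma)$ is the number of descents. Binomial convention: for integers $m$ and $n\ge0$, $\binom{m}{n}=\frac{m(m-1)\cdots(m-n+1)}{n!}$ if $m\ge n$ and $\binom{m}{n}=0$ if $m<n$ (including negative $m$). The $b$-shuffle measure on $S_n$ is $Q_b(\sigma)=\binom{n+b-d(\sigma^{ -1})-1}{n}/b^n$ (this is the law of the permutation produced by one $b$-shuffle of the Gilbert–Shannon–Reeds type: cut into $b$ packets multinomially and riffle dropping cards with probability proportional to packet size). It is known that performing an $a$-shuffle followed by a $b$-shuffle gives the law $Q_{ab}$, so $r$ successive $b$-shuffles from the identity yield law $Q_{b^r}$. The base-$b$ carries chain for adding $n$ numbers is the Markov chain $\kappa_0=0,\kappa_1,\kappa_2,\dots$ on $\{0,1,\dots,n-1\}$ given by $\kappa_{t+1}=\lfloor(\kappa_t+X_{t+1,1}+\dots+X_{t+1,n})/b\rfloor$, where the $X_{t,k}$ are i.i.d. uniform on $\{0,1,\dots,b-1\}$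 (the carries when $n$ random base-$b$ integers are added column by column). Its transition matrix is $P_b(i,j)=b^{ -n}\sum_{l=0}^{j-\lfloor i/b\rfloor}(-1)^l\binom{n+1}{l}\binom{n-1-i+(j+1-l)b}{n}$, and $P_b^r$ denotes its $r$-step transition matrix. -}

module Defs where

open import Data.Fin.Base using (Fin; zero; suc; toℕ; inject₁; fromℕ<; punchIn)
open import Data.Fin.Permutation
  using (Permutation′; _⟨$⟩ʳ_; _≈_; id; flip; insert; remove; insert-remove)
import Data.Fin.Properties as Fin
open import Data.Integer.Base as ℤ using (ℤ; +_; -[1+_]; 0ℤ; 1ℤ; -1ℤ)
open import Data.List.Base
  using (List; []; _∷_; map; foldr; filter; length; allFin; upTo; cartesianProductWith)
open import Data.List.Membership.Propositional.Properties using (∈-allFin)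
open import Data.List.Relation.Unary.All as All using (All; []; _∷_)
open import Data.List.Relation.Unary.All.Properties as AllP using ()
open import Data.List.Relation.Unary.Any using (Any; here)
open import Data.List.Relation.Unary.Any.Properties as AnyP using ()
open import Data.List.Relation.Unary.AllPairs as AllPairs using (AllPairs; []; _∷_)
open import Data.List.Relation.Unary.AllPairs.Properties as AllPairsP using ()
open import Data.List.Relation.Unary.Unique.Propositional using (Unique)
open import Data.List.Relation.Unary.Unique.Propositional.Properties using (allFin⁺)
open import Data.Nat.Base
  using (ℕ; zero; suc; _+_; _∸_; _^_; _/_; NonZero; >-nonZero⁻¹)
open import Data.Nat.Combinatorics using (_C_)
open import Data.Nat.Properties using (_≟_; m^n≢0)
open import Data.Rational.Base as ℚ using (ℚ; 0ℚ; 1ℚ)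
open import Data.Vec.Base as Vec using (Vec; []; _∷_)
open import Relation.Binary.PropositionalEquality
  using (_≡_; refl; sym; trans; cong)
open import Relation.Nullary using (¬_; yes; no)

sumℤ : List ℤ → ℤ
sumℤ = foldr ℤ._+_ 0ℤ

sumℚ : List ℚ → ℚ
sumℚ = foldr ℚ._+_ 0ℚ

-- The binomial coefficient with an integer upper argument, equal to 0 whenever
-- m < k, in particular for every negative m (not the polynomial extension).
-- The library's  m C k  is already 0 for m < k.
binom : ℤ → ℕ → ℤ
binom (+ m)    k = + (m C k)
binom -[1+ _ ] k = 0ℤ

words : {A : Set} → List A → (k : ℕ) → List (Vec A k)
words xs zero    = [] ∷ []
words xs (suc k) = cartesianProductWith _∷_ xs (words xs k)

-- All of Sₙ, each permutation listed once up to pointwise equality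
-- (permutations-complete and permutations-unique below): choose the image j of
-- the first point and a permutation of what remains.
permutations : (n : ℕ) → List (Permutation′ n)
permutations zero    = id ∷ []
permutations (suc n) = cartesianProductWith (insert zero) (allFin (suc n)) (permutations n)

-- For n = suc m the possible descent positions are the m pairs of neighbours
-- (inject₁ i , suc i), i : Fin m.
descents : {n : ℕ} → Permutation′ n → ℕ
descents {zero}  σ = 0
descents {suc m} σ =
  length (filter (λ i → (σ ⟨$⟩ʳ suc i) Fin.<? (σ ⟨$⟩ʳ inject₁ i)) (allFin m))

-- The b-shuffle measure; flip is the inverse permutation.
Q : {n : ℕ} (b : ℕ) .{{_ : NonZero b}} → Permutation′ n → ℚ
Q {n} b σ =
  ℚ._/_ (binom (+ n ℤ.+ + b ℤ.- + descents (flip σ) ℤ.- 1ℤ) n)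
        (b ^ n) {{m^n≢0 b n}}

probDescents : {n : ℕ} → (Permutation′ n → ℚ) → ℕ → ℚ
probDescents {n} μ j =
  sumℚ (map μ (filter (λ σ → descents σ ≟ j) (permutations n)))

-- The state reached from state k after reading the given columns in order, the
-- head of the vector being the next column X_{t+1,1}, …, X_{t+1,n}.
carry : {n b r : ℕ} .{{_ : NonZero b}} → ℕ → Vec (Vec (Fin b) n) r → ℕ
carry         k []       = k
carry {b = b} k (x ∷ xs) = carry ((k + Vec.sum (Vec.map toℕ x)) / b) xs

-- Since κ₀, …, κ_r depend only on the first r columns, whose r·n digits are
-- independent and uniform, the law of κ_r is the image of the uniform measure
-- on the (bⁿ)ʳ tables of digits.
probCarry : (n b r : ℕ) .{{_ : NonZero b}} → ℕ → ℚ
probCarry n b r j =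
  ℚ._/_ (+ length (filter (λ X → carry 0 X ≟ j) (words (words (allFin b) n) r)))
        ((b ^ n) ^ r) {{m^n≢0 (b ^ n) r {{m^n≢0 b n}}}}

Matrix : ℕ → Set
Matrix n = Fin n → Fin n → ℚ

_^ᴹ_ : {n : ℕ} → Matrix n → ℕ → Matrix n
(M ^ᴹ zero)  i j with i Fin.≟ j
... | yes _ = 1ℚ
... | no  _ = 0ℚ
_^ᴹ_ {n} M (suc r) i j = sumℚ (map (λ k → M i k ℚ.* (M ^ᴹ r) k j) (allFin n))

-- l ranges over 0, …, j - ⌊i/b⌋; truncated subtraction makes the range empty
-- when j < ⌊i/b⌋.
P : (n b : ℕ) .{{_ : NonZero b}} → Matrix n
P n b i j =
  ℚ._/_ (sumℤ (map term (upTo (suc (toℕ j) ∸ toℕ i / b)))) (b ^ n) {{m^n≢0 b n}}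
  where
  term : ℕ → ℤ
  term l =
    (-1ℤ ℤ.^ l)
      ℤ.* binom (+ suc n) l
      ℤ.* binom (+ n ℤ.- 1ℤ ℤ.- + toℕ i ℤ.+ (+ toℕ j ℤ.+ 1ℤ ℤ.- + l) ℤ.* + b) n

state0 : (n : ℕ) .{{_ : NonZero n}} → Fin n
state0 n = fromℕ< (>-nonZero⁻¹ n)

private
  insert-cong : ∀ {n} j {π ρ : Permutation′ n} → π ≈ ρ → insert zero j π ≈ insert zero j ρ
  insert-cong j p zero    = refl
  insert-cong j p (suc k) = cong (punchIn j) (p k)

  insert-injective : ∀ {n} j {π ρ : Permutation′ n} →
                     insert zero j π ≈ insert zero j ρ → π ≈ ρ
  insert-injective j p k = Fin.punchIn-injective j _ _ (p (suc k))

permutations-complete : ∀ {n} (π : Permutation′ n) → Any (π ≈_) (permutations n)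
permutations-complete {zero}  π = here λ ()
permutations-complete {suc n} π =
  AnyP.cartesianProductWith⁺ (insert zero)
    (λ { refl q i → trans (sym (insert-remove zero π i)) (insert-cong _ q i) })
    (∈-allFin (π ⟨$⟩ʳ zero)) (permutations-complete (remove zero π))

permutations-unique : ∀ n → AllPairs (λ π ρ → ¬ π ≈ ρ) (permutations n)
permutations-unique zero    = [] ∷ []
permutations-unique (suc n) = go (allFin (suc n)) (allFin⁺ (suc n))
  where
  ps = permutations n

  fresh : ∀ j {π : Permutation′ n} js → All (λ k → ¬ j ≡ k) js →
          All (λ ρ → ¬ insert zero j π ≈ ρ) (cartesianProductWith (insert zero) js ps)
  fresh j []       []         = []
  fresh j (k ∷ js) (j≢k ∷ ne) =
    AllP.++⁺ (AllP.map⁺ (All.universal (λ ρ p → j≢k (p zero)) ps)) (fresh j js ne)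

  go : ∀ js → Unique js →
       AllPairs (λ π ρ → ¬ π ≈ ρ) (cartesianProductWith (insert zero) js ps)
  go []       []       = []
  go (j ∷ js) (ne ∷ u) =
    AllPairsP.++⁺
      (AllPairsP.map⁺ (AllPairs.map (λ π≉ρ p → π≉ρ (insert-injective j p)) (permutations-unique n)))
      (go js u)
      (AllP.map⁺ (All.universal (λ π → fresh j js ne) ps))

{-# OPTIONS --safe #-}
module Submission where

-- Writing B = bʳ, the r columns of digits are the base-b expansions of n numbers
-- x₁, …, xₙ < B, so κ_r = ⌊(x₁ + ⋯ + xₙ) / B⌋. The partial sums y_k = x₁ + ⋯ + x_k
-- mod B run through all words of length n over {0, …, B - 1}, and the quotient counts
-- the wrap-arounds, that is, the descents of the word y. Each word has exactly one
-- standardization σ, with the same descents; and y ↦ y ∘ σ⁻¹ identifies the words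
-- standardizing to σ with the weakly increasing words that increase strictly at the
-- descents of σ⁻¹, of which there are C(n + B - 1 - d(σ⁻¹), n).
--
-- The transition matrix P is the inclusion-exclusion count of the columns leading
-- from i to j: the number of x ∈ {0, …, b - 1}ᵏ with sum below s is the k-th backward
-- difference of step b of the number of such x ∈ ℕᵏ.

open import Data.Bool.Base using (if_then_else_; true; false)
open import Data.Fin.Base as Fin using (Fin; zero; suc; toℕ; inject₁; punchIn; fromℕ<)
import Data.Fin.Induction as Fin using (<-weakInduction)
open import Data.Fin.Permutation
  using (Permutation′; _⟨$⟩ʳ_; _⟨$⟩ˡ_; inverseʳ; inverseˡ; insert; flip)
import Data.Fin.Properties as Fin
open import Data.Integer.Base as ℤ using (ℤ; +_; -[1+_]; 0ℤ; 1ℤ; -1ℤ)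
import Data.Integer.Properties as ℤ
open import Data.Integer.Tactic.RingSolver using (solve-∀)
open import Data.List.Base as List
  using (List; []; _∷_; map; filter; length; allFin; upTo; _++_; cartesianProductWith)
import Data.List.Properties as List
open import Data.Nat.Base as ℕ
  using (ℕ; zero; suc; _+_; _*_; _∸_; _^_; _/_; _≤_; _<_; NonZero; z≤n; s≤s; s≤s⁻¹; >-nonZero⁻¹)
open import Data.Nat.Combinatorics using (_C_; nCk+nC[k+1]≡[n+1]C[k+1]; k>n⇒nCk≡0; nC1≡n)
open import Data.Nat.DivMod
open import Data.Nat.Divisibility using (n∣m*n; ∣-refl)
open import Data.Nat.Properties using (m^n≢0)
import Data.Nat.Properties as ℕ
open import Data.Nat.Tactic.RingSolver using () renaming (solve-∀ to ℕ-solve-∀)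
open import Data.Product.Base using (_×_; _,_; proj₁; proj₂; ∃)
open import Data.Rational.Base as ℚ using (toℚᵘ)
import Data.Rational.Properties as ℚ
open import Data.Rational.Unnormalised.Base as ℚᵘ using (mkℚᵘ; *≡*)
import Data.Rational.Unnormalised.Properties as ℚᵘ
open import Data.Sum.Base using (_⊎_; inj₁; inj₂; [_,_]′)
open import Data.Vec.Base as Vec using (Vec; []; _∷_; lookup; tabulate)
import Data.Vec.Properties as Vec
open import Function.Base using (_∘_)
open import Level using (Level)
open import Relation.Binary.Definitions using (tri<; tri≈; tri>; DecidableEquality)
open import Relation.Binary.PropositionalEquality
open import Relation.Nullary using (¬_; Dec; yes; no; does; _×-dec_; _⊎-dec_; _→-dec_)
open import Relation.Nullary.Decidable using (dec-true; dec-false)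
open import Relation.Nullary.Negation using (contradiction)
open import Relation.Unary using (Pred; Decidable)
open import Defs

-- All counts are sums of `ℤ`-valued indicators: unique existence says that such a sum is `1ℤ`, and
-- double counting is an exchange of two sums. The carry is fed to an arbitrary `F : ℕ → ℤ` because
-- the induction on partial sums changes the observable: after a wrap-around, `F` becomes `F ∘ suc`.
-- Both σ and its inverse appear because a word is read in two orders. Read by position,
-- neighbouring letters descend exactly where σ does. Read by rank, the letters are sorted, and two
-- letters of consecutive ranks may be equal only if they stand from left to right; where σ⁻¹
-- descends they stand from right to left, so the rise must be strict.

private variable
  A B D : Set
  ℓ ℓ′ : Level
  n m b : ℕ

-- Finite sums and indicators

⟦_⟧ : {X : Set ℓ} → Dec X → ℤ
⟦ X? ⟧ = if does X? then 1ℤ else 0ℤ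

⟦⟧-true : {X : Set ℓ} (X? : Dec X) → X → ⟦ X? ⟧ ≡ 1ℤ
⟦⟧-true (yes _) x = refl
⟦⟧-true (no ¬x) x = contradiction x ¬x

⟦⟧-false : {X : Set ℓ} (X? : Dec X) → ¬ X → ⟦ X? ⟧ ≡ 0ℤ
⟦⟧-false (yes x) ¬x = contradiction x ¬x
⟦⟧-false (no _)  ¬x = refl

⟦⟧-cong : {X : Set ℓ} {Y : Set ℓ′} (X? : Dec X) (Y? : Dec Y) →
          (X → Y) → (Y → X) → ⟦ X? ⟧ ≡ ⟦ Y? ⟧
⟦⟧-cong (yes x) Y? f g = sym (⟦⟧-true Y? (f x))
⟦⟧-cong (no ¬x) Y? f g = sym (⟦⟧-false Y? (¬x ∘ g))

⟦⟧-× : {X : Set ℓ} {Y : Set ℓ′} (X? : Dec X) (Y? : Dec Y) →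
       ⟦ X? ×-dec Y? ⟧ ≡ ⟦ X? ⟧ ℤ.* ⟦ Y? ⟧
⟦⟧-× (yes _) Y? = sym (ℤ.*-identityˡ _)
⟦⟧-× (no _)  Y? = refl

⟦⟧-*-cong : {X : Set ℓ} (X? : Dec X) {a b : ℤ} → (X → a ≡ b) → ⟦ X? ⟧ ℤ.* a ≡ ⟦ X? ⟧ ℤ.* b
⟦⟧-*-cong (yes x) e = cong (1ℤ ℤ.*_) (e x)
⟦⟧-*-cong (no _)  e = refl

+-congʳ : ∀ a {b c : ℤ} → b ≡ c → a ℤ.+ b ≡ a ℤ.+ c
+-congʳ a = cong (λ z → a ℤ.+ z)

∑ : List A → (A → ℤ) → ℤ
∑ xs f = sumℤ (map f xs)

∑-cong : (xs : List A) {f g : A → ℤ} → (∀ x → f x ≡ g x) → ∑ xs f ≡ ∑ xs g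
∑-cong []       e = refl
∑-cong (x ∷ xs) e = cong₂ ℤ._+_ (e x) (∑-cong xs e)

∑-zero : (xs : List A) {f : A → ℤ} → (∀ x → f x ≡ 0ℤ) → ∑ xs f ≡ 0ℤ
∑-zero []       e = refl
∑-zero (x ∷ xs) e = cong₂ ℤ._+_ (e x) (∑-zero xs e)

∑-+ : (xs : List A) (f g : A → ℤ) → ∑ xs (λ x → f x ℤ.+ g x) ≡ ∑ xs f ℤ.+ ∑ xs g
∑-+ []       f g = refl
∑-+ (x ∷ xs) f g = trans (+-congʳ (f x ℤ.+ g x) (∑-+ xs f g)) (interchange (f x) (g x) _ _)
  where
  interchange : ∀ a b c d → a ℤ.+ b ℤ.+ (c ℤ.+ d) ≡ a ℤ.+ c ℤ.+ (b ℤ.+ d)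
  interchange = solve-∀

∑-*ˡ : (xs : List A) (c : ℤ) (f : A → ℤ) → ∑ xs (λ x → c ℤ.* f x) ≡ c ℤ.* ∑ xs f
∑-*ˡ []       c f = sym (ℤ.*-zeroʳ c)
∑-*ˡ (x ∷ xs) c f = trans (+-congʳ (c ℤ.* f x) (∑-*ˡ xs c f)) (sym (ℤ.*-distribˡ-+ c (f x) (∑ xs f)))

∑-*ʳ : (xs : List A) (c : ℤ) (f : A → ℤ) → ∑ xs (λ x → f x ℤ.* c) ≡ ∑ xs f ℤ.* c
∑-*ʳ xs c f = trans (∑-cong xs (λ x → ℤ.*-comm (f x) c)) (trans (∑-*ˡ xs c f) (ℤ.*-comm c _))

∑-- : (xs : List A) (f g : A → ℤ) → ∑ xs (λ x → f x ℤ.- g x) ≡ ∑ xs f ℤ.- ∑ xs g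
∑-- []       f g = refl
∑-- (x ∷ xs) f g = trans (+-congʳ (f x ℤ.- g x) (∑-- xs f g)) (interchange (f x) (g x) _ _)
  where
  interchange : ∀ a b c d → a ℤ.- b ℤ.+ (c ℤ.- d) ≡ a ℤ.+ c ℤ.- (b ℤ.+ d)
  interchange = solve-∀

∑-comm : (xs : List A) (ys : List B) (f : A → B → ℤ) →
         ∑ xs (λ x → ∑ ys (f x)) ≡ ∑ ys (λ y → ∑ xs (λ x → f x y))
∑-comm []       ys f = sym (∑-zero ys (λ _ → refl))
∑-comm (x ∷ xs) ys f = trans (+-congʳ (∑ ys (f x)) (∑-comm xs ys f)) (sym (∑-+ ys (f x) _))

∑-++ : (xs ys : List A) (f : A → ℤ) → ∑ (xs ++ ys) f ≡ ∑ xs f ℤ.+ ∑ ys f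
∑-++ []       ys f = sym (ℤ.+-identityˡ _)
∑-++ (x ∷ xs) ys f = trans (+-congʳ (f x) (∑-++ xs ys f)) (sym (ℤ.+-assoc (f x) (∑ xs f) (∑ ys f)))

∑-map : (xs : List A) (h : A → B) (f : B → ℤ) → ∑ (map h xs) f ≡ ∑ xs (f ∘ h)
∑-map xs h f = cong sumℤ (sym (List.map-∘ xs))

∑-cartesian : (h : A → B → D) (xs : List A) (ys : List B) (f : D → ℤ) →
              ∑ (cartesianProductWith h xs ys) f ≡ ∑ xs (λ x → ∑ ys (λ y → f (h x y)))
∑-cartesian h []       ys f = refl
∑-cartesian h (x ∷ xs) ys f =
  trans (∑-++ (map (h x) ys) _ f) (cong₂ ℤ._+_ (∑-map ys (h x) f) (∑-cartesian h xs ys f))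

∑-filter : {P : Pred A ℓ} (P? : Decidable P) (xs : List A) (f : A → ℤ) →
           ∑ (filter P? xs) f ≡ ∑ xs (λ x → ⟦ P? x ⟧ ℤ.* f x)
∑-filter P? []       f = refl
∑-filter P? (x ∷ xs) f with P? x
... | yes _ = cong₂ ℤ._+_ (sym (ℤ.*-identityˡ (f x))) (∑-filter P? xs f)
... | no  _ = trans (∑-filter P? xs f) (sym (ℤ.+-identityˡ _))

length-filter≡∑ : {P : Pred A ℓ} (P? : Decidable P) (xs : List A) →
                  + length (filter P? xs) ≡ ∑ xs (λ x → ⟦ P? x ⟧)
length-filter≡∑ P? []       = refl
length-filter≡∑ P? (x ∷ xs) with P? x
... | yes _ = cong (ℤ.suc) (length-filter≡∑ P? xs)
... | no  _ = trans (length-filter≡∑ P? xs) (sym (ℤ.+-identityˡ _))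

∑-upTo-suc : ∀ n (f : ℕ → ℤ) → ∑ (upTo (suc n)) f ≡ f 0 ℤ.+ ∑ (upTo n) (f ∘ suc)
∑-upTo-suc n f = cong (λ l → f 0 ℤ.+ sumℤ l)
  (trans (List.map-applyUpTo suc f n) (sym (List.map-upTo (f ∘ suc) n)))

∑-upTo-+ : ∀ m n (f : ℕ → ℤ) → ∑ (upTo (m + n)) f ≡ ∑ (upTo m) f ℤ.+ ∑ (upTo n) (λ i → f (m + i))
∑-upTo-+ zero    n f = sym (ℤ.+-identityˡ _)
∑-upTo-+ (suc m) n f = begin
  ∑ (upTo (suc (m + n))) f  ≡⟨ ∑-upTo-suc (m + n) f ⟩
  f 0 ℤ.+ ∑ (upTo (m + n)) (f ∘ suc)  ≡⟨ +-congʳ (f 0) (∑-upTo-+ m n (f ∘ suc)) ⟩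
  f 0 ℤ.+ (∑ (upTo m) (f ∘ suc) ℤ.+ rest)   ≡⟨ ℤ.+-assoc (f 0) _ rest ⟨
  f 0 ℤ.+ ∑ (upTo m) (f ∘ suc) ℤ.+ rest     ≡⟨ cong (ℤ._+ rest) (∑-upTo-suc m f) ⟨
  ∑ (upTo (suc m)) f ℤ.+ rest               ∎
  where
  open ≡-Reasoning
  rest = ∑ (upTo n) (λ i → f (suc m + i))

∑-upTo-cong : ∀ n {f g : ℕ → ℤ} → (∀ i → i < n → f i ≡ g i) → ∑ (upTo n) f ≡ ∑ (upTo n) g
∑-upTo-cong zero    e = refl
∑-upTo-cong (suc n) {f} {g} e = trans (∑-upTo-suc n f) (trans
  (cong₂ ℤ._+_ (e 0 (s≤s z≤n)) (∑-upTo-cong n (λ i i<n → e (suc i) (s≤s i<n)))) (sym (∑-upTo-suc n g)))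

∑-allFin-suc : ∀ n (f : Fin (suc n) → ℤ) → ∑ (allFin (suc n)) f ≡ f zero ℤ.+ ∑ (allFin n) (f ∘ suc)
∑-allFin-suc n f = cong (λ l → f zero ℤ.+ sumℤ l)
  (trans (List.map-tabulate suc f) (sym (List.map-tabulate (λ i → i) (f ∘ suc))))

∑-allFin : ∀ n (f : ℕ → ℤ) → ∑ (allFin n) (f ∘ toℕ) ≡ ∑ (upTo n) f
∑-allFin zero    f = refl
∑-allFin (suc n) f = trans (∑-allFin-suc n (f ∘ toℕ))
  (trans (+-congʳ (f 0) (∑-allFin n (f ∘ suc))) (sym (∑-upTo-suc n f)))

-- Turns unique existence into an equation that can be multiplied into other sums.
∑-allFin-unique : ∀ {n} {P : Fin n → Set ℓ} (P? : ∀ i → Dec (P i)) (c : Fin n) →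
                  P c → (∀ i → P i → i ≡ c) → ∑ (allFin n) (λ i → ⟦ P? i ⟧) ≡ 1ℤ
∑-allFin-unique {n = suc n} P? zero pc u = trans (∑-allFin-suc n (λ i → ⟦ P? i ⟧))
  (cong₂ ℤ._+_ (⟦⟧-true (P? zero) pc)
    (∑-zero (allFin n) (λ i → ⟦⟧-false (P? (suc i)) (λ pi → contradiction (u (suc i) pi) λ ()))))
∑-allFin-unique {n = suc n} P? (suc c) pc u = trans (∑-allFin-suc n (λ i → ⟦ P? i ⟧))
  (cong₂ ℤ._+_ (⟦⟧-false (P? zero) (λ p0 → contradiction (u zero p0) λ ()))
    (∑-allFin-unique (P? ∘ suc) c pc (λ i pi → Fin.suc-injective (u (suc i) pi))))

-- Sums of digits, carries and descents of words

∑-words-suc : (xs : List A) (k : ℕ) (f : Vec A (suc k) → ℤ) →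
              ∑ (words xs (suc k)) f ≡ ∑ xs (λ x → ∑ (words xs k) (λ v → f (x ∷ v)))
∑-words-suc xs k = ∑-cartesian _∷_ xs (words xs k)

digitSum : Vec (Fin b) n → ℕ
digitSum x = Vec.sum (Vec.map toℕ x)

-- A carry sees a column only through the sum of its digits, so counts of columns take this shape.
∑ᵈ : (n b : ℕ) → (ℕ → ℤ) → ℤ
∑ᵈ n b F = ∑ (words (allFin b) n) (F ∘ digitSum)

∑ᵈ-cong : ∀ n b {F G : ℕ → ℤ} → (∀ s → F s ≡ G s) → ∑ᵈ n b F ≡ ∑ᵈ n b G
∑ᵈ-cong n b e = ∑-cong (words (allFin b) n) (e ∘ digitSum)

∑ᵈ-suc : ∀ n b F → ∑ᵈ (suc n) b F ≡ ∑ (upTo b) (λ x → ∑ᵈ n b (λ s → F (x + s)))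
∑ᵈ-suc n b F = trans (∑-words-suc (allFin b) n (F ∘ digitSum))
                     (∑-allFin b (λ x → ∑ᵈ n b (λ s → F (x + s))))

∑-upTo-* : ∀ B b (f : ℕ → ℤ) →
           ∑ (upTo (B * b)) f ≡ ∑ (upTo B) (λ x → ∑ (upTo b) (λ c → f (x * b + c)))
∑-upTo-* zero    b f = refl
∑-upTo-* (suc B) b f = begin
  ∑ (upTo (b + B * b)) f
    ≡⟨ ∑-upTo-+ b (B * b) f ⟩
  ∑ (upTo b) f ℤ.+ ∑ (upTo (B * b)) (λ i → f (b + i))
    ≡⟨ +-congʳ (∑ (upTo b) f) (∑-upTo-* B b (λ i → f (b + i))) ⟩
  ∑ (upTo b) f ℤ.+ ∑ (upTo B) (λ x → ∑ (upTo b) (λ c → f (b + (x * b + c))))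
    ≡⟨ +-congʳ (∑ (upTo b) f) (∑-cong (upTo B) (λ x → ∑-cong (upTo b) (λ c →
         cong f (sym (ℕ.+-assoc b (x * b) c))))) ⟩
  ∑ (upTo b) f ℤ.+ ∑ (upTo B) (λ x → ∑ (upTo b) (λ c → f (suc x * b + c)))
    ≡⟨ ∑-upTo-suc B (λ x → ∑ (upTo b) (λ c → f (x * b + c))) ⟨
  ∑ (upTo (suc B)) (λ x → ∑ (upTo b) (λ c → f (x * b + c))) ∎
  where open ≡-Reasoning

-- Splits off the lowest digit of each of the `n` summands: `s` is the sum of these digits and `t`
-- the sum of the quotients by `b`, which range over all numbers below `B`.
∑ᵈ-* : ∀ n B b F → ∑ᵈ n (B * b) F ≡ ∑ᵈ n b (λ s → ∑ᵈ n B (λ t → F (s + t * b)))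
∑ᵈ-* zero    B b F = sym (ℤ.+-identityʳ (F 0 ℤ.+ 0ℤ))
∑ᵈ-* (suc n) B b F = begin
  ∑ᵈ (suc n) (B * b) F
    ≡⟨ ∑ᵈ-suc n (B * b) F ⟩
  ∑ (upTo (B * b)) (λ y → ∑ᵈ n (B * b) (λ u → F (y + u)))
    ≡⟨ ∑-upTo-* B b (λ y → ∑ᵈ n (B * b) (λ u → F (y + u))) ⟩
  ∑ (upTo B) (λ x → ∑ (upTo b) (λ c → ∑ᵈ n (B * b) (λ u → F (x * b + c + u))))
    ≡⟨ ∑-cong (upTo B) (λ x → ∑-cong (upTo b) (λ c → trans
         (∑ᵈ-* n B b (λ u → F (x * b + c + u)))
         (∑ᵈ-cong n b (λ s → ∑ᵈ-cong n B (λ t → cong F (regroup x b c s t)))))) ⟩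
  ∑ (upTo B) (λ x → ∑ (upTo b) (λ c → ∑ᵈ n b (λ s → ∑ᵈ n B (λ t → F (c + s + (x + t) * b)))))
    ≡⟨ ∑-comm (upTo B) (upTo b)
         (λ x c → ∑ᵈ n b (λ s → ∑ᵈ n B (λ t → F (c + s + (x + t) * b)))) ⟩
  ∑ (upTo b) (λ c → ∑ (upTo B) (λ x → ∑ᵈ n b (λ s → ∑ᵈ n B (λ t → F (c + s + (x + t) * b)))))
    ≡⟨ ∑-cong (upTo b) (λ c → ∑-comm (upTo B) (words (allFin b) n)
         (λ x v → ∑ᵈ n B (λ t → F (c + digitSum v + (x + t) * b)))) ⟩
  ∑ (upTo b) (λ c → ∑ᵈ n b (λ s → ∑ (upTo B) (λ x → ∑ᵈ n B (λ t → F (c + s + (x + t) * b)))))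
    ≡⟨ ∑-cong (upTo b) (λ c → ∑ᵈ-cong n b (λ s → ∑ᵈ-suc n B (λ t → F (c + s + t * b)))) ⟨
  ∑ (upTo b) (λ c → ∑ᵈ n b (λ s → ∑ᵈ (suc n) B (λ t → F (c + s + t * b))))
    ≡⟨ ∑ᵈ-suc n b (λ s → ∑ᵈ (suc n) B (λ t → F (s + t * b))) ⟨
  ∑ᵈ (suc n) b (λ s → ∑ᵈ (suc n) B (λ t → F (s + t * b))) ∎
  where
  open ≡-Reasoning
  regroup : ∀ x b c s t → x * b + c + (s + t * b) ≡ c + s + (x + t) * b
  regroup = ℕ-solve-∀

-- The first column holds the least significant digits. By induction the remaining columns act as
-- one column in base `b ^ r`, and rounding down twice agrees with rounding down once. The start `k`
-- is arbitrary since the induction restarts from the carry of the first column.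
∑-carry : ∀ n b r .{{_ : NonZero b}} (F : ℕ → ℤ) k →
  ∑ (words (words (allFin b) n) r) (F ∘ carry k) ≡
  ∑ᵈ n (b ^ r) (λ s → F (ℕ._/_ (k + s) (b ^ r) {{ℕ.m^n≢0 b r}}))
∑-carry n b zero F k = sym (∑ᵈ-one n)
  where
  ∑ᵈ-one : ∀ n {k} → ∑ᵈ n 1 (λ s → F ((k + s) / 1)) ≡ F k ℤ.+ 0ℤ
  ∑ᵈ-one zero    {k} = cong (λ m → F m ℤ.+ 0ℤ) (trans (n/1≡n (k + 0)) (ℕ.+-identityʳ k))
  ∑ᵈ-one (suc n) {k} = trans (∑ᵈ-suc n 1 (λ s → F ((k + s) / 1))) (trans (ℤ.+-identityʳ _) (∑ᵈ-one n))
∑-carry n b (suc r) F k = begin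
  ∑ (words columns (suc r)) (F ∘ carry k)
    ≡⟨ ∑-words-suc columns r (F ∘ carry k) ⟩
  ∑ columns (λ x → ∑ (words columns r) (F ∘ carry ((k + digitSum x) / b)))
    ≡⟨ ∑-cong columns (λ x → ∑-carry n b r F ((k + digitSum x) / b)) ⟩
  ∑ᵈ n b (λ s → ∑ᵈ n (b ^ r) (λ t → F (((k + s) / b + t) / b ^ r)))
    ≡⟨ ∑ᵈ-cong n b (λ s → ∑ᵈ-cong n (b ^ r) (λ t → cong F (divide s t))) ⟨
  ∑ᵈ n b (λ s → ∑ᵈ n (b ^ r) (λ t → F ((k + (s + t * b)) / b ^ suc r)))
    ≡⟨ ∑ᵈ-* n (b ^ r) b (λ s → F ((k + s) / b ^ suc r)) ⟨
  ∑ᵈ n (b ^ r * b) (λ s → F ((k + s) / b ^ suc r))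
    ≡⟨ cong (λ B → ∑ᵈ n B (λ s → F ((k + s) / b ^ suc r))) (ℕ.*-comm (b ^ r) b) ⟩
  ∑ᵈ n (b ^ suc r) (λ s → F ((k + s) / b ^ suc r)) ∎
  where
  open ≡-Reasoning
  columns = words (allFin b) n
  instance
    _ = ℕ.m^n≢0 b r
    _ = ℕ.m^n≢0 b (suc r)
  divide : ∀ s t → (k + (s + t * b)) / b ^ suc r ≡ ((k + s) / b + t) / b ^ r
  divide s t = begin
    (k + (s + t * b)) / (b * b ^ r)     ≡⟨ m/n/o≡m/[n*o] (k + (s + t * b)) b (b ^ r) ⟨
    (k + (s + t * b)) / b / b ^ r       ≡⟨ cong (λ m → m / b / b ^ r) (ℕ.+-assoc k s (t * b)) ⟨
    (k + s + t * b) / b / b ^ r         ≡⟨ cong (_/ b ^ r) (+-distrib-/-∣ʳ (k + s) (n∣m*n t)) ⟩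
    ((k + s) / b + t * b / b) / b ^ r   ≡⟨ cong (λ m → ((k + s) / b + m) / b ^ r) (m*n/n≡m t b) ⟩
    ((k + s) / b + t) / b ^ r           ∎

drop : ℕ → ℕ → ℕ
drop p y = if does (y ℕ.<? p) then 1 else 0

-- `p` is the letter before the word. Since no letter lies below 0, `wordDescents 0` counts the
-- descents inside the word alone.
wordDescents : ℕ → Vec (Fin b) n → ℕ
wordDescents p []      = 0
wordDescents p (y ∷ v) = drop p (toℕ y) + wordDescents (toℕ y) v

drop-< : ∀ {p y} → y < p → drop p y ≡ 1
drop-< {p} {y} y<p = cong (if_then 1 else 0) (dec-true (y ℕ.<? p) y<p)

drop-≮ : ∀ {p y} → ¬ y < p → drop p y ≡ 0
drop-≮ {p} {y} y≮p = cong (if_then 1 else 0) (dec-false (y ℕ.<? p) y≮p)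

-- `p` is the current partial sum modulo `B`. Adding the next number rotates the residues by `p`:
-- the first `B ∸ p` values land at or above `p`, with neither wrap-around nor descent; the other
-- `p` values wrap and land below `p`, which is a descent.
∑-wrap : ∀ n B .{{_ : NonZero B}} (F : ℕ → ℤ) {p} → p < B →
         ∑ᵈ n B (λ s → F ((p + s) / B)) ≡ ∑ (words (allFin B) n) (F ∘ wordDescents p)
∑-wrap zero    B F {p} p<B =
  cong (λ m → F m ℤ.+ 0ℤ) (trans (cong (_/ B) (ℕ.+-identityʳ p)) (m<n⇒m/n≡0 p<B))
∑-wrap (suc n) B F {p} p<B = begin
  ∑ᵈ (suc n) B (λ s → F ((p + s) / B))
    ≡⟨ ∑ᵈ-suc n B (λ s → F ((p + s) / B)) ⟩
  ∑ (upTo B) G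
    ≡⟨ cong (λ m → ∑ (upTo m) G) (sym q+p≡B) ⟩
  ∑ (upTo (q + p)) G
    ≡⟨ ∑-upTo-+ q p G ⟩
  ∑ (upTo q) G ℤ.+ ∑ (upTo p) (λ i → G (q + i))
    ≡⟨ cong₂ ℤ._+_ (∑-upTo-cong q no-wrap) (∑-upTo-cong p wrap) ⟩
  ∑ (upTo q) (λ x → K (p + x)) ℤ.+ ∑ (upTo p) K
    -- Exchanging the two blocks undoes the rotation and lists the new letter in increasing order.
    ≡⟨ ℤ.+-comm (∑ (upTo q) (λ x → K (p + x))) (∑ (upTo p) K) ⟩
  ∑ (upTo p) K ℤ.+ ∑ (upTo q) (λ x → K (p + x))
    ≡⟨ ∑-upTo-+ p q K ⟨
  ∑ (upTo (p + q)) K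
    ≡⟨ cong (λ m → ∑ (upTo m) K) (trans (ℕ.+-comm p q) q+p≡B) ⟩
  ∑ (upTo B) K
    ≡⟨ ∑-allFin B K ⟨
  ∑ (allFin B) (K ∘ toℕ)
    ≡⟨ ∑-words-suc (allFin B) n (F ∘ wordDescents p) ⟨
  ∑ (words (allFin B) (suc n)) (F ∘ wordDescents p) ∎
  where
  open ≡-Reasoning
  q = B ∸ p
  q+p≡B : q + p ≡ B
  q+p≡B = ℕ.m∸n+n≡m (ℕ.<⇒≤ p<B)
  G K : ℕ → ℤ
  G x = ∑ᵈ n B (λ s → F ((p + (x + s)) / B))
  K y = ∑ (words (allFin B) n) (λ v → F (drop p y + wordDescents y v))

  no-wrap : ∀ x → x < q → G x ≡ K (p + x)
  no-wrap x x<q = begin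
    G x
      ≡⟨ ∑ᵈ-cong n B (λ s → cong (λ m → F (m / B)) (sym (ℕ.+-assoc p x s))) ⟩
    ∑ᵈ n B (λ s → F ((p + x + s) / B))
      ≡⟨ ∑-wrap n B F (subst (p + x <_) (trans (ℕ.+-comm p q) q+p≡B) (ℕ.+-monoʳ-< p x<q)) ⟩
    ∑ (words (allFin B) n) (F ∘ wordDescents (p + x))
      ≡⟨ ∑-cong (words (allFin B) n) (λ v → cong (λ d → F (d + wordDescents (p + x) v))
           (drop-≮ (ℕ.≤⇒≯ (ℕ.m≤m+n p x)))) ⟨
    K (p + x) ∎

  wrap : ∀ i → i < p → G (q + i) ≡ K i
  wrap i i<p = begin
    G (q + i)
      ≡⟨ ∑ᵈ-cong n B (λ s → cong F (carry-out s)) ⟩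
    ∑ᵈ n B (λ s → F (suc ((i + s) / B)))
      ≡⟨ ∑-wrap n B (F ∘ suc) (ℕ.<-trans i<p p<B) ⟩
    ∑ (words (allFin B) n) (F ∘ suc ∘ wordDescents i)
      ≡⟨ ∑-cong (words (allFin B) n) (λ v → cong (λ d → F (d + wordDescents i v)) (drop-< i<p)) ⟨
    K i ∎
    where
    regroup : ∀ p q i s → p + (q + i + s) ≡ q + p + (i + s)
    regroup = ℕ-solve-∀
    carry-out : ∀ s → (p + (q + i + s)) / B ≡ suc ((i + s) / B)
    carry-out s = begin
      (p + (q + i + s)) / B     ≡⟨ cong (_/ B) (regroup p q i s) ⟩
      (q + p + (i + s)) / B     ≡⟨ cong (λ m → (m + (i + s)) / B) q+p≡B ⟩
      (B + (i + s)) / B         ≡⟨ +-distrib-/-∣ˡ (i + s) ∣-refl ⟩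
      B / B + (i + s) / B       ≡⟨ cong (_+ (i + s) / B) (n/n≡1 B) ⟩
      suc ((i + s) / B)         ∎

-- Standardization

⟨$⟩ʳ-injective : (σ : Permutation′ n) {i k : Fin n} → σ ⟨$⟩ʳ i ≡ σ ⟨$⟩ʳ k → i ≡ k
⟨$⟩ʳ-injective σ e = trans (sym (inverseˡ σ)) (trans (cong (σ ⟨$⟩ˡ_) e) (inverseˡ σ))

Lex : (Fin n → ℕ) → Fin n → Fin n → Set
Lex w i k = w i < w k ⊎ (w i ≡ w k × i Fin.< k)

lex? : (w : Fin n → ℕ) (i k : Fin n) → Dec (Lex w i k)
lex? w i k = w i ℕ.<? w k ⊎-dec (w i ℕ.≟ w k ×-dec i Fin.<? k)

Lex⇒≤ : (w : Fin n → ℕ) {i k : Fin n} → Lex w i k → w i ≤ w k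
Lex⇒≤ w (inj₁ lt)      = ℕ.<⇒≤ lt
Lex⇒≤ w (inj₂ (e , _)) = ℕ.≤-reflexive e

Lex⇒< : (w : Fin n → ℕ) {i k : Fin n} → k Fin.< i → Lex w i k → w i < w k
Lex⇒< w k<i (inj₁ lt)        = lt
Lex⇒< w k<i (inj₂ (_ , i<k)) = contradiction i<k (ℕ.<-asym k<i)

≤⇒Lex : (w : Fin n → ℕ) {i k : Fin n} → i Fin.< k → w i ≤ w k → Lex w i k
≤⇒Lex w i<k le = [ inj₁ , (λ e → inj₂ (e , i<k)) ]′ (ℕ.m≤n⇒m<n∨m≡n le)

-- σ is the standardization of the word w: it ranks the letters of w, equal
-- letters from left to right.
Standardizes : Permutation′ n → (Fin n → ℕ) → Set
Standardizes σ w = ∀ i k → σ ⟨$⟩ʳ i Fin.< σ ⟨$⟩ʳ k → Lex w i k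

standardizes? : (σ : Permutation′ n) (w : Fin n → ℕ) → Dec (Standardizes σ w)
standardizes? σ w =
  Fin.all? λ i → Fin.all? λ k → (σ ⟨$⟩ʳ i Fin.<? σ ⟨$⟩ʳ k) →-dec lex? w i k

-- `j` is a possible rank for a letter `c` placed in front of `w`. Being leftmost, `c` precedes the
-- letters equal to it, hence the strict inequality below `j` and the weak one from `j` on.
Threshold : (Fin n → ℕ) → ℕ → Permutation′ n → Fin (suc n) → Set
Threshold w c π j = ∀ k → (π ⟨$⟩ʳ k Fin.< j → w k < c) × (j Fin.≤ π ⟨$⟩ʳ k → c ≤ w k)

threshold? : (w : Fin n → ℕ) (c : ℕ) (π : Permutation′ n) (j : Fin (suc n)) → Dec (Threshold w c π j)
threshold? w c π j = Fin.all? λ k →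
  ((π ⟨$⟩ʳ k Fin.<? j) →-dec (w k ℕ.<? c)) ×-dec ((j Fin.≤? π ⟨$⟩ʳ k) →-dec (c ℕ.≤? w k))

punchIn-mono-< : ∀ (i : Fin (suc n)) (j k : Fin n) → j Fin.< k → punchIn i j Fin.< punchIn i k
punchIn-mono-< i j k j<k = ℕ.≰⇒> (ℕ.<⇒≱ j<k ∘ Fin.punchIn-cancel-≤ i k j)

punchIn-cancel-< : ∀ (i : Fin (suc n)) (j k : Fin n) → punchIn i j Fin.< punchIn i k → j Fin.< k
punchIn-cancel-< i j k lt = ℕ.≰⇒> (ℕ.<⇒≱ lt ∘ Fin.punchIn-mono-≤ i k j)

punchIn-below : ∀ (i : Fin (suc n)) (j : Fin n) → j Fin.< i → punchIn i j Fin.< i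
punchIn-below (suc i) zero    _         = s≤s z≤n
punchIn-below (suc i) (suc j) (s≤s j<i) = s≤s (punchIn-below i j j<i)

punchIn-above : ∀ (i : Fin (suc n)) (j : Fin n) → i Fin.≤ j → i Fin.< punchIn i j
punchIn-above zero    j       _         = s≤s z≤n
punchIn-above (suc i) (suc j) (s≤s i≤j) = s≤s (punchIn-above i j i≤j)

module _ (w : Fin (suc n) → ℕ) (j : Fin (suc n)) (π : Permutation′ n) where

  -- `insert zero j π` gives the first letter rank `j` and raises the ranks of `π` from `j` on by
  -- one. The order inside the tail is untouched, and only comparisons with the first letter are
  -- new.
  standardizes-insert⁻ : Standardizes (insert zero j π) w →
                         Standardizes π (w ∘ suc) × Threshold (w ∘ suc) (w zero) π j
  standardizes-insert⁻ std = tail , λ k →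
      (λ lt → Lex⇒< w (s≤s z≤n) (std (suc k) zero (punchIn-below j _ lt)))
    , (λ le → Lex⇒≤ w (std zero (suc k) (punchIn-above j _ le)))
    where
    tail : Standardizes π (w ∘ suc)
    tail i k lt with std (suc i) (suc k) (punchIn-mono-< j _ _ lt)
    ... | inj₁ l             = inj₁ l
    ... | inj₂ (e , s≤s i<k) = inj₂ (e , i<k)

  standardizes-insert⁺ : Standardizes π (w ∘ suc) × Threshold (w ∘ suc) (w zero) π j →
                         Standardizes (insert zero j π) w
  standardizes-insert⁺ (std , thr) zero    zero    lt = contradiction lt (ℕ.<-irrefl refl)
  standardizes-insert⁺ (std , thr) zero    (suc k) lt =
    ≤⇒Lex w (s≤s z≤n) (proj₂ (thr k) (ℕ.≮⇒≥ (ℕ.<-asym lt ∘ punchIn-below j _)))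
  standardizes-insert⁺ (std , thr) (suc i) zero    lt =
    inj₁ (proj₁ (thr i) (ℕ.≰⇒> (ℕ.<-asym lt ∘ punchIn-above j _)))
  standardizes-insert⁺ (std , thr) (suc i) (suc k) lt with std i k (punchIn-cancel-< j _ _ lt)
  ... | inj₁ l         = inj₁ l
  ... | inj₂ (e , i<k) = inj₂ (e , s≤s i<k)

-- The bound lies in `Fin (suc n)` since the initial segment may be all of `Fin n`.
downward-closed-bound :
  {T : Fin n → Set} (T? : ∀ a → Dec (T a)) → (∀ {a b} → a Fin.< b → T b → T a) →
  ∃ λ (j : Fin (suc n)) → ∀ a → (a Fin.< j → T a) × (j Fin.≤ a → ¬ T a)
downward-closed-bound {zero}  T? down = zero , λ ()
downward-closed-bound {suc n} T? down with T? zero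
... | no ¬T0 = zero , λ where
  zero    → (λ ()) , λ _ → ¬T0
  (suc a) → (λ ()) , λ _ → ¬T0 ∘ down (s≤s z≤n)
... | yes T0 with downward-closed-bound (T? ∘ suc) (down ∘ s≤s)
... | j , bound = suc j , λ where
  zero    → (λ _ → T0) , λ ()
  (suc a) → proj₁ (bound a) ∘ s≤s⁻¹ , proj₂ (bound a) ∘ s≤s⁻¹

-- Along the inverse of `π` the letters of `w` increase weakly, so the ranks with letter below `c`
-- form an initial segment, and its end is the only threshold.
∑-threshold : (w : Fin n → ℕ) (c : ℕ) (π : Permutation′ n) → Standardizes π w →
              ∑ (allFin (suc n)) (λ j → ⟦ threshold? w c π j ⟧) ≡ 1ℤ
∑-threshold {n} w c π std =
  ∑-allFin-unique (threshold? w c π) j thr (λ i thrᵢ → Fin.toℕ-injective (unique i thrᵢ))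
  where
  bound = downward-closed-bound (λ a → w (π ⟨$⟩ˡ a) ℕ.<? c) λ {a} {b} a<b lt →
    ℕ.≤-<-trans (Lex⇒≤ w (std _ _ (subst₂ Fin._<_ (sym (inverseʳ π)) (sym (inverseʳ π)) a<b))) lt

  j : Fin (suc n)
  j = proj₁ bound

  thr : Threshold w c π j
  thr k with proj₂ bound (π ⟨$⟩ʳ k)
  ... | below , above rewrite inverseˡ π {k} = below , ℕ.≮⇒≥ ∘ above

  ordered : ∀ {i i′} → Threshold w c π i → Threshold w c π i′ → ¬ i Fin.< i′
  ordered {i} {i′} t t′ i<i′ =
    -- The rank `toℕ i` is not below `i` but is below `i′`, so its letter would be both at least `c`
    -- and less than `c`.
    ℕ.<⇒≱ (proj₁ (t′ k) (subst (Fin._< i′) (sym (inverseʳ π)) (subst (_< toℕ i′) (sym toℕ-a) i<i′)))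
          (proj₂ (t k) (subst (i Fin.≤_) (sym (inverseʳ π)) (ℕ.≤-reflexive (sym toℕ-a))))
    where
    i<n : toℕ i < n
    i<n = ℕ.<-≤-trans i<i′ (s≤s⁻¹ (Fin.toℕ<n i′))
    k = π ⟨$⟩ˡ fromℕ< i<n
    toℕ-a : toℕ (fromℕ< i<n) ≡ toℕ i
    toℕ-a = Fin.toℕ-fromℕ< i<n

  unique : ∀ i → Threshold w c π i → toℕ i ≡ toℕ j
  unique i t = ℕ.≤-antisym (ℕ.≮⇒≥ (ordered thr t)) (ℕ.≮⇒≥ (ordered t thr))

∑-standardizes : ∀ n (w : Fin n → ℕ) → ∑ (permutations n) (λ σ → ⟦ standardizes? σ w ⟧) ≡ 1ℤ
∑-standardizes zero    w = refl
∑-standardizes (suc n) w = begin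
  ∑ (permutations (suc n)) (λ σ → ⟦ standardizes? σ w ⟧)
    ≡⟨ ∑-cartesian (insert zero) (allFin (suc n)) (permutations n) (λ σ → ⟦ standardizes? σ w ⟧) ⟩
  ∑ (allFin (suc n)) (λ j → ∑ (permutations n) (λ π → ⟦ standardizes? (insert zero j π) w ⟧))
    ≡⟨ ∑-comm (allFin (suc n)) (permutations n) (λ j π → ⟦ standardizes? (insert zero j π) w ⟧) ⟩
  ∑ (permutations n) (λ π → ∑ (allFin (suc n)) (λ j → ⟦ standardizes? (insert zero j π) w ⟧))
    ≡⟨ ∑-cong (permutations n) choices ⟩
  ∑ (permutations n) (λ π → ⟦ standardizes? π (w ∘ suc) ⟧)
    ≡⟨ ∑-standardizes n (w ∘ suc) ⟩
  1ℤ ∎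
  where
  open ≡-Reasoning
  choices : ∀ π → ∑ (allFin (suc n)) (λ j → ⟦ standardizes? (insert zero j π) w ⟧) ≡
                  ⟦ standardizes? π (w ∘ suc) ⟧
  choices π = begin
    ∑ (allFin (suc n)) (λ j → ⟦ standardizes? (insert zero j π) w ⟧)
      ≡⟨ ∑-cong (allFin (suc n)) (λ j → trans
           (⟦⟧-cong (standardizes? (insert zero j π) w) (tail? ×-dec threshold? (w ∘ suc) (w zero) π j)
              (standardizes-insert⁻ w j π) (standardizes-insert⁺ w j π))
           (⟦⟧-× tail? (threshold? (w ∘ suc) (w zero) π j))) ⟩
    ∑ (allFin (suc n)) (λ j → ⟦ tail? ⟧ ℤ.* ⟦ threshold? (w ∘ suc) (w zero) π j ⟧)
      ≡⟨ ∑-*ˡ (allFin (suc n)) ⟦ tail? ⟧ (λ j → ⟦ threshold? (w ∘ suc) (w zero) π j ⟧) ⟩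
    ⟦ tail? ⟧ ℤ.* ∑ (allFin (suc n)) (λ j → ⟦ threshold? (w ∘ suc) (w zero) π j ⟧)
      -- `∑-threshold` assumes that `π` standardizes the tail; otherwise the first factor is 0.
      ≡⟨ ⟦⟧-*-cong tail? (∑-threshold (w ∘ suc) (w zero) π) ⟩
    ⟦ tail? ⟧ ℤ.* 1ℤ
      ≡⟨ ℤ.*-identityʳ ⟦ tail? ⟧ ⟩
    ⟦ tail? ⟧ ∎
    where
    tail? = standardizes? π (w ∘ suc)

drop≡⟦⟧ : ∀ p y → + drop p y ≡ ⟦ y ℕ.<? p ⟧
drop≡⟦⟧ p y with y ℕ.<ᵇ p
... | true  = refl
... | false = refl

letters : Vec (Fin b) n → Fin n → ℕ
letters y = toℕ ∘ lookup y

wordDescents≡∑ : (y : Vec (Fin b) (suc m)) → + wordDescents 0 y ≡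
  ∑ (allFin m) (λ i → ⟦ letters y (suc i) ℕ.<? letters y (inject₁ i) ⟧)
wordDescents≡∑ (x ∷ [])    = refl
wordDescents≡∑ {m = suc m} (x ∷ y ∷ v) = begin
  + (drop (toℕ x) (toℕ y) + wordDescents 0 (y ∷ v))
    ≡⟨ ℤ.pos-+ (drop (toℕ x) (toℕ y)) (wordDescents 0 (y ∷ v)) ⟩
  + drop (toℕ x) (toℕ y) ℤ.+ + wordDescents 0 (y ∷ v)
    ≡⟨ cong₂ ℤ._+_ (drop≡⟦⟧ (toℕ x) (toℕ y)) (wordDescents≡∑ (y ∷ v)) ⟩
  ⟦ toℕ y ℕ.<? toℕ x ⟧ ℤ.+ ∑ (allFin m) (λ i → ⟦ letters (y ∷ v) (suc i) ℕ.<? letters (y ∷ v) (inject₁ i) ⟧)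
    ≡⟨ ∑-allFin-suc m (λ i → ⟦ letters (x ∷ y ∷ v) (suc i) ℕ.<? letters (x ∷ y ∷ v) (inject₁ i) ⟧) ⟨
  ∑ (allFin (suc m)) (λ i → ⟦ letters (x ∷ y ∷ v) (suc i) ℕ.<? letters (x ∷ y ∷ v) (inject₁ i) ⟧) ∎
  where
  open ≡-Reasoning

-- A tie between neighbours is ranked from left to right, hence is no descent of `σ`; so `σ`
-- descends exactly where the letters do.
descents-standardization : (σ : Permutation′ n) (y : Vec (Fin b) n) →
                           Standardizes σ (letters y) → descents σ ≡ wordDescents 0 y
descents-standardization {zero}  σ [] std = refl
descents-standardization {suc m} σ y  std = ℤ.+-injective (begin
  + descents σ
    ≡⟨ length-filter≡∑ (λ i → (σ ⟨$⟩ʳ suc i) Fin.<? (σ ⟨$⟩ʳ inject₁ i)) (allFin m) ⟩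
  ∑ (allFin m) (λ i → ⟦ (σ ⟨$⟩ʳ suc i) Fin.<? (σ ⟨$⟩ʳ inject₁ i) ⟧)
    ≡⟨ ∑-cong (allFin m) (λ i → ⟦⟧-cong ((σ ⟨$⟩ʳ suc i) Fin.<? (σ ⟨$⟩ʳ inject₁ i))
         (letters y (suc i) ℕ.<? letters y (inject₁ i))
         (Lex⇒< (letters y) (inject₁<suc i) ∘ std (suc i) (inject₁ i)) (reflect i)) ⟩
  ∑ (allFin m) (λ i → ⟦ letters y (suc i) ℕ.<? letters y (inject₁ i) ⟧)
    ≡⟨ wordDescents≡∑ y ⟨
  + wordDescents 0 y ∎)
  where
  open ≡-Reasoning
  inject₁<suc : ∀ i → inject₁ i Fin.< suc i
  inject₁<suc i = s≤s (ℕ.≤-reflexive (Fin.toℕ-inject₁ i))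
  reflect : ∀ i → letters y (suc i) < letters y (inject₁ i) → σ ⟨$⟩ʳ suc i Fin.< σ ⟨$⟩ʳ inject₁ i
  reflect i lt with Fin.<-cmp (σ ⟨$⟩ʳ suc i) (σ ⟨$⟩ʳ inject₁ i)
  ... | tri< l _ _ = l
  ... | tri≈ _ e _ = contradiction (cong toℕ (sym (⟨$⟩ʳ-injective σ e))) (ℕ.<⇒≢ (inject₁<suc i))
  ... | tri> _ _ g = contradiction lt (ℕ.≤⇒≯ (Lex⇒≤ (letters y) (std (inject₁ i) (suc i) g)))

-- Words with a given standardization

Enumerates : DecidableEquality A → List A → Set
Enumerates _≟_ xs = ∀ c → ∑ xs (λ x → ⟦ x ≟ c ⟧) ≡ 1ℤ

-- Inserting the factor `∑ xs (λ x → ⟦ x ≟ h y ⟧)`, which is 1, and exchanging the sums trades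
-- `x ≡ h y` for `y ≡ g x`, so the list itself is never rearranged.
∑-reindex : (_≟_ : DecidableEquality A) (xs : List A) → Enumerates _≟_ xs →
            (g h : A → A) → (∀ x → h (g x) ≡ x) → (∀ y → g (h y) ≡ y) →
            (f : A → ℤ) → ∑ xs f ≡ ∑ xs (f ∘ g)
∑-reindex _≟_ xs enum g h hg gh f = begin
  ∑ xs f
    ≡⟨ ∑-cong xs (λ y → sym (trans (cong (ℤ._* f y) (enum (h y))) (ℤ.*-identityˡ (f y)))) ⟩
  ∑ xs (λ y → ∑ xs (λ x → ⟦ x ≟ h y ⟧) ℤ.* f y)
    ≡⟨ ∑-cong xs (λ y → ∑-*ʳ xs (f y) (λ x → ⟦ x ≟ h y ⟧)) ⟨
  ∑ xs (λ y → ∑ xs (λ x → ⟦ x ≟ h y ⟧ ℤ.* f y))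
    ≡⟨ ∑-comm xs xs (λ y x → ⟦ x ≟ h y ⟧ ℤ.* f y) ⟩
  ∑ xs (λ x → ∑ xs (λ y → ⟦ x ≟ h y ⟧ ℤ.* f y))
    ≡⟨ ∑-cong xs (λ x → ∑-cong xs (λ y → trans (cong (ℤ._* f y)
         (⟦⟧-cong (x ≟ h y) (y ≟ g x) (λ e → trans (sym (gh y)) (cong g (sym e)))
                                      (λ e → trans (sym (hg x)) (cong h (sym e)))))
         (⟦⟧-*-cong (y ≟ g x) (cong f)))) ⟩
  ∑ xs (λ x → ∑ xs (λ y → ⟦ y ≟ g x ⟧ ℤ.* f (g x)))
    ≡⟨ ∑-cong xs (λ x → ∑-*ʳ xs (f (g x)) (λ y → ⟦ y ≟ g x ⟧)) ⟩
  ∑ xs (λ x → ∑ xs (λ y → ⟦ y ≟ g x ⟧) ℤ.* f (g x))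
    ≡⟨ ∑-cong xs (λ x → trans (cong (ℤ._* f (g x)) (enum (g x))) (ℤ.*-identityˡ (f (g x)))) ⟩
  ∑ xs (f ∘ g) ∎
  where open ≡-Reasoning

allFin-enumerates : ∀ n → Enumerates Fin._≟_ (allFin n)
allFin-enumerates n c = ∑-allFin-unique (Fin._≟ c) c refl (λ _ e → e)

words-enumerates : (_≟_ : DecidableEquality A) (xs : List A) → Enumerates _≟_ xs →
                   ∀ k → Enumerates (Vec.≡-dec _≟_) (words xs k)
words-enumerates _≟_ xs enum zero    []      = refl
words-enumerates _≟_ xs enum (suc k) (c ∷ u) = begin
  ∑ (words xs (suc k)) (λ v → ⟦ Vec.≡-dec _≟_ v (c ∷ u) ⟧)
    ≡⟨ ∑-words-suc xs k (λ v → ⟦ Vec.≡-dec _≟_ v (c ∷ u) ⟧) ⟩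
  ∑ xs (λ x → ∑ (words xs k) (λ v → ⟦ Vec.≡-dec _≟_ (x ∷ v) (c ∷ u) ⟧))
    ≡⟨ ∑-cong xs (λ x → ∑-cong (words xs k) (λ v → trans
         (⟦⟧-cong (Vec.≡-dec _≟_ (x ∷ v) (c ∷ u)) (x ≟ c ×-dec Vec.≡-dec _≟_ v u)
            Vec.∷-injective (λ (p , q) → cong₂ _∷_ p q))
         (⟦⟧-× (x ≟ c) (Vec.≡-dec _≟_ v u)))) ⟩
  ∑ xs (λ x → ∑ (words xs k) (λ v → ⟦ x ≟ c ⟧ ℤ.* ⟦ Vec.≡-dec _≟_ v u ⟧))
    ≡⟨ ∑-cong xs (λ x → trans (∑-*ˡ (words xs k) ⟦ x ≟ c ⟧ (λ v → ⟦ Vec.≡-dec _≟_ v u ⟧))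
         (trans (cong (λ s → ⟦ x ≟ c ⟧ ℤ.* s) (words-enumerates _≟_ xs enum k u))
                (ℤ.*-identityʳ ⟦ x ≟ c ⟧))) ⟩
  ∑ xs (λ x → ⟦ x ≟ c ⟧)
    ≡⟨ enum c ⟩
  1ℤ ∎
  where open ≡-Reasoning

-- The word `z ∘ σ`. If `σ` standardizes `y`, then `y` is `permute σ z` with `z` the sorted
-- rearrangement of `y`.
permute : Permutation′ n → Vec A n → Vec A n
permute σ z = tabulate (λ i → lookup z (σ ⟨$⟩ʳ i))

permute-flip : (σ : Permutation′ n) (z : Vec A n) → permute (flip σ) (permute σ z) ≡ z
permute-flip σ z = trans (Vec.tabulate-cong (λ i → trans
  (Vec.lookup∘tabulate (λ k → lookup z (σ ⟨$⟩ʳ k)) (σ ⟨$⟩ˡ i)) (cong (lookup z) (inverseʳ σ))))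
  (Vec.tabulate∘lookup z)

-- The tie-break `u` is kept apart from the index because letters listed by rank have their ties
-- broken by their position `σ ⟨$⟩ˡ a` in the original word.
lex-transitive : {w u : Fin n → ℕ} {i j k : Fin n} →
  w i < w j ⊎ (w i ≡ w j × u i < u j) → w j < w k ⊎ (w j ≡ w k × u j < u k) →
  w i < w k ⊎ (w i ≡ w k × u i < u k)
lex-transitive (inj₁ p)       (inj₁ q)       = inj₁ (ℕ.<-trans p q)
lex-transitive (inj₁ p)       (inj₂ (e , _)) = inj₁ (ℕ.<-≤-trans p (ℕ.≤-reflexive e))
lex-transitive (inj₂ (e , _)) (inj₁ q)       = inj₁ (ℕ.≤-<-trans (ℕ.≤-reflexive e) q)
lex-transitive (inj₂ (e , p)) (inj₂ (f , q)) = inj₂ (trans e f , ℕ.<-trans p q)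

adjacent⇒all : {R : Fin (suc m) → Fin (suc m) → Set} → (∀ {i j k} → R i j → R j k → R i k) →
               (∀ i → R (inject₁ i) (suc i)) → ∀ {i k} → i Fin.< k → R i k
adjacent⇒all {m} {R} R-trans adj {i} {k} i<k = go k i<k
  where
  step : ∀ k → (i Fin.< inject₁ k → R i (inject₁ k)) → i Fin.< suc k → R i (suc k)
  step k ih (s≤s i≤k) with ℕ.m≤n⇒m<n∨m≡n i≤k
  ... | inj₁ i<k = R-trans (ih (subst (toℕ i <_) (sym (Fin.toℕ-inject₁ k)) i<k)) (adj k)
  ... | inj₂ i≡k = subst (λ j → R j (suc k))
                     (Fin.toℕ-injective (trans (Fin.toℕ-inject₁ k) (sym i≡k))) (adj k)
  go : ∀ k → i Fin.< k → R i k
  go = Fin.<-weakInduction (λ k → i Fin.< k → R i k) (λ ()) step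

-- `s i` is the least rise demanded between neighbours: 0 for a weak step, 1 for a strict one.
Staircase : (Fin m → ℕ) → Vec (Fin b) (suc m) → Set
Staircase s z = ∀ i → letters z (inject₁ i) + s i ≤ letters z (suc i)

staircase? : (s : Fin m → ℕ) (z : Vec (Fin b) (suc m)) → Dec (Staircase s z)
staircase? s z = Fin.all? λ i → letters z (inject₁ i) + s i ℕ.≤? letters z (suc i)

-- The indicator of the descents of `τ`, named for the rise it demands of a sorted word when `τ` is
-- the inverse of a standardization.
rises : Permutation′ (suc m) → Fin m → ℕ
rises τ i = drop (toℕ (τ ⟨$⟩ʳ inject₁ i)) (toℕ (τ ⟨$⟩ʳ suc i))

module _ (σ : Permutation′ (suc m)) (z : Vec (Fin b) (suc m)) where

  private
    lookup-permute : ∀ i → lookup (permute σ z) i ≡ lookup z (σ ⟨$⟩ʳ i)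
    lookup-permute = Vec.lookup∘tabulate (λ k → lookup z (σ ⟨$⟩ʳ k))

    Precedes : Fin (suc m) → Fin (suc m) → Set
    Precedes a c = letters z a < letters z c ⊎
      (letters z a ≡ letters z c × σ ⟨$⟩ˡ a Fin.< σ ⟨$⟩ˡ c)

    at : ∀ a → lookup (permute σ z) (σ ⟨$⟩ˡ a) ≡ lookup z a
    at a = trans (lookup-permute (σ ⟨$⟩ˡ a)) (cong (lookup z) (inverseʳ σ))

  standardizes⇒staircase : Standardizes σ (letters (permute σ z)) → Staircase (rises (flip σ)) z
  standardizes⇒staircase std i = go (σ ⟨$⟩ˡ suc i Fin.<? σ ⟨$⟩ˡ inject₁ i)
    where
    lex : Lex (letters (permute σ z)) (σ ⟨$⟩ˡ inject₁ i) (σ ⟨$⟩ˡ suc i)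
    lex = std _ _ (subst₂ Fin._<_ (sym (inverseʳ σ)) (sym (inverseʳ σ))
                    (s≤s (ℕ.≤-reflexive (Fin.toℕ-inject₁ i))))
    here : letters z (inject₁ i) ≤ letters z (suc i)
    here = subst₂ (λ x y → toℕ x ≤ toℕ y) (at (inject₁ i)) (at (suc i)) (Lex⇒≤ (letters (permute σ z)) lex)
    go : Dec (σ ⟨$⟩ˡ suc i Fin.< σ ⟨$⟩ˡ inject₁ i) →
         letters z (inject₁ i) + rises (flip σ) i ≤ letters z (suc i)
    -- At a descent of the inverse the smaller rank stands further right, which excludes a tie.
    go (yes lt) rewrite drop-< lt = subst (_≤ letters z (suc i)) (ℕ.+-comm 1 _)
      (subst₂ (λ x y → toℕ x < toℕ y) (at (inject₁ i)) (at (suc i)) (Lex⇒< (letters (permute σ z)) lt lex))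
    go (no ≮)   rewrite drop-≮ ≮ = subst (_≤ letters z (suc i)) (sym (ℕ.+-identityʳ _)) here

  -- A staircase constrains consecutive ranks only; transitivity of `Precedes` extends this to all
  -- pairs of ranks.
  staircase⇒standardizes : Staircase (rises (flip σ)) z → Standardizes σ (letters (permute σ z))
  staircase⇒standardizes stairs i k lt = transport
    (adjacent⇒all {R = Precedes}
       (λ {a} {c} {d} → lex-transitive {w = letters z} {u = λ a → toℕ (σ ⟨$⟩ˡ a)} {a} {c} {d})
       adjacent lt)
    where
    transport : Precedes (σ ⟨$⟩ʳ i) (σ ⟨$⟩ʳ k) → Lex (letters (permute σ z)) i k
    transport pr rewrite lookup-permute i | lookup-permute k | inverseˡ σ {i} | inverseˡ σ {k} = pr

    adjacent : ∀ i → Precedes (inject₁ i) (suc i)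
    adjacent i with Fin.<-cmp (σ ⟨$⟩ˡ suc i) (σ ⟨$⟩ˡ inject₁ i)
    ... | tri< l _ _ = inj₁ (subst (_≤ letters z (suc i)) (ℕ.+-comm _ 1)
                         (subst (λ d → letters z (inject₁ i) + d ≤ letters z (suc i)) (drop-< l) (stairs i)))
    ... | tri≈ _ e _ = contradiction (trans (sym (Fin.toℕ-inject₁ i))
                         (cong toℕ (sym (⟨$⟩ʳ-injective (flip σ) e)))) (ℕ.<⇒≢ (ℕ.n<1+n (toℕ i)))
    ... | tri> _ _ g = [ inj₁ , (λ e → inj₂ (e , g)) ]′
                         (ℕ.m≤n⇒m<n∨m≡n (ℕ.≤-trans (ℕ.m≤m+n _ _) (stairs i)))

∑-standardizes≡∑-staircase : ∀ b (σ : Permutation′ (suc m)) →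
  ∑ (words (allFin b) (suc m)) (λ y → ⟦ standardizes? σ (letters y) ⟧) ≡
  ∑ (words (allFin b) (suc m)) (λ z → ⟦ staircase? (rises (flip σ)) z ⟧)
∑-standardizes≡∑-staircase {m} b σ = trans
  (∑-reindex (Vec.≡-dec Fin._≟_) (words (allFin b) (suc m))
    (words-enumerates Fin._≟_ (allFin b) (allFin-enumerates b) (suc m)) (permute σ) (permute (flip σ))
    (permute-flip σ) (permute-flip (flip σ)) (λ y → ⟦ standardizes? σ (letters y) ⟧))
  (∑-cong (words (allFin b) (suc m)) (λ z →
    ⟦⟧-cong (standardizes? σ (letters (permute σ z))) (staircase? (rises (flip σ)) z)
      (standardizes⇒staircase σ z) (staircase⇒standardizes σ z)))

-- Counting staircases with prescribed weak and strict steps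

weakSteps : (Fin m → ℕ) → ℕ
weakSteps {zero}  s = 0
weakSteps {suc m} s = 1 ∸ s zero + weakSteps (s ∘ suc)

weakSteps-≤ : (s : Fin m → ℕ) → weakSteps s ≤ m
weakSteps-≤ {zero}  s = z≤n
weakSteps-≤ {suc m} s = ℕ.+-mono-≤ (ℕ.m∸n≤m 1 (s zero)) (weakSteps-≤ (s ∘ suc))

pascal : ∀ n k → + (suc n C suc k) ≡ + (n C k) ℤ.+ + (n C suc k)
pascal n k = trans (cong +_ (sym (nCk+nC[k+1]≡[n+1]C[k+1] n k))) (ℤ.pos-+ (n C k) (n C suc k))

∑-≥ : ∀ b lo (f : ℕ → ℤ) →
      ∑ (upTo b) (λ x → ⟦ lo ℕ.≤? x ⟧ ℤ.* f x) ≡ ∑ (upTo (b ∸ lo)) (λ i → f (lo + i))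
∑-≥ b       zero     f = ∑-cong (upTo b) (λ x → ℤ.*-identityˡ (f x))
∑-≥ zero    (suc lo) f = refl
∑-≥ (suc b) (suc lo) f = begin
  ∑ (upTo (suc b)) (λ x → ⟦ suc lo ℕ.≤? x ⟧ ℤ.* f x)
    ≡⟨ ∑-upTo-suc b (λ x → ⟦ suc lo ℕ.≤? x ⟧ ℤ.* f x) ⟩
  0ℤ ℤ.+ ∑ (upTo b) (λ x → ⟦ suc lo ℕ.≤? suc x ⟧ ℤ.* f (suc x))
    ≡⟨ ℤ.+-identityˡ _ ⟩
  ∑ (upTo b) (λ x → ⟦ suc lo ℕ.≤? suc x ⟧ ℤ.* f (suc x))
    ≡⟨ ∑-cong (upTo b) (λ x → cong (ℤ._* f (suc x))
         (⟦⟧-cong (suc lo ℕ.≤? suc x) (lo ℕ.≤? x) s≤s⁻¹ s≤s)) ⟩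
  ∑ (upTo b) (λ x → ⟦ lo ℕ.≤? x ⟧ ℤ.* f (suc x))
    ≡⟨ ∑-≥ b lo (f ∘ suc) ⟩
  ∑ (upTo (b ∸ lo)) (λ i → f (suc (lo + i))) ∎
  where open ≡-Reasoning

-- Of `u` available values a letter skips `i` and leaves `u ∸ (i + s)` for the next letter. Pascal's
-- rule then sums the binomial coefficients.
hockey-stick : ∀ {s} → s ≤ 1 → ∀ e k → e ≤ k → ∀ u →
  ∑ (upTo u) (λ i → + ((u ∸ (i + s) + e) C suc k)) ≡ + ((u + (1 ∸ s + e)) C suc (suc k))
hockey-stick {s} s≤1 e k e≤k zero =
  -- With no values left the upper index is at most `1 + k`, below the lower index `2 + k`; this is
  -- where `e ≤ k` enters.
  cong +_ (sym (k>n⇒nCk≡0 (s≤s (ℕ.+-mono-≤ (ℕ.m∸n≤m 1 s) e≤k))))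
hockey-stick {s} s≤1 e k e≤k (suc u) = begin
  ∑ (upTo (suc u)) (λ i → + ((suc u ∸ (i + s) + e) C suc k))
    ≡⟨ ∑-upTo-suc u (λ i → + ((suc u ∸ (i + s) + e) C suc k)) ⟩
  + ((suc u ∸ s + e) C suc k) ℤ.+ ∑ (upTo u) (λ i → + ((u ∸ (i + s) + e) C suc k))
    ≡⟨ cong₂ ℤ._+_ (cong (λ v → + (v C suc k)) (shift s≤1)) (hockey-stick s≤1 e k e≤k u) ⟩
  + ((u + (1 ∸ s + e)) C suc k) ℤ.+ + ((u + (1 ∸ s + e)) C suc (suc k))
    ≡⟨ pascal (u + (1 ∸ s + e)) (suc k) ⟨
  + (suc (u + (1 ∸ s + e)) C suc (suc k)) ∎
  where
  open ≡-Reasoning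
  shift : ∀ {s} → s ≤ 1 → suc u ∸ s + e ≡ u + (1 ∸ s + e)
  shift z≤n       = sym (ℕ.+-suc u e)
  shift (s≤s z≤n) = refl

staircase-∷ : (s : Fin (suc m) → ℕ) (x y : Fin b) (v : Vec (Fin b) m) →
  ⟦ staircase? s (x ∷ y ∷ v) ⟧ ≡ ⟦ toℕ x + s zero ℕ.≤? toℕ y ⟧ ℤ.* ⟦ staircase? (s ∘ suc) (y ∷ v) ⟧
staircase-∷ s x y v = trans
  (⟦⟧-cong (staircase? s (x ∷ y ∷ v)) (toℕ x + s zero ℕ.≤? toℕ y ×-dec staircase? (s ∘ suc) (y ∷ v))
    (λ st → st zero , st ∘ suc) (λ { (h , t) zero → h ; (h , t) (suc i) → t i }))
  (⟦⟧-× (toℕ x + s zero ℕ.≤? toℕ y) (staircase? (s ∘ suc) (y ∷ v)))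

-- Adding to each letter the number of weak steps before it turns a staircase into a strictly
-- increasing sequence below `b + weakSteps s`, hence the binomial coefficient. The bound `lo` on
-- the first letter makes the tail after `x` an instance of the same statement, with bound
-- `toℕ x + s zero`.
∑-staircase-from : ∀ b m (s : Fin m → ℕ) → (∀ i → s i ≤ 1) → ∀ lo →
  ∑ (words (allFin b) (suc m)) (λ z → ⟦ lo ℕ.≤? letters z zero ⟧ ℤ.* ⟦ staircase? s z ⟧) ≡
  + ((b ∸ lo + weakSteps s) C suc m)
∑-staircase-from b zero s s≤1 lo = begin
  ∑ (words (allFin b) 1) (λ z → ⟦ lo ℕ.≤? letters z zero ⟧ ℤ.* 1ℤ)
    ≡⟨ ∑-words-suc (allFin b) 0 (λ z → ⟦ lo ℕ.≤? letters z zero ⟧ ℤ.* 1ℤ) ⟩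
  ∑ (allFin b) (λ x → ⟦ lo ℕ.≤? toℕ x ⟧ ℤ.* 1ℤ ℤ.+ 0ℤ)
    ≡⟨ ∑-cong (allFin b) (λ x → ℤ.+-identityʳ (⟦ lo ℕ.≤? toℕ x ⟧ ℤ.* 1ℤ)) ⟩
  ∑ (allFin b) (λ x → ⟦ lo ℕ.≤? toℕ x ⟧ ℤ.* 1ℤ)
    ≡⟨ ∑-allFin b (λ x → ⟦ lo ℕ.≤? x ⟧ ℤ.* 1ℤ) ⟩
  ∑ (upTo b) (λ x → ⟦ lo ℕ.≤? x ⟧ ℤ.* 1ℤ)
    ≡⟨ ∑-≥ b lo (λ _ → 1ℤ) ⟩
  ∑ (upTo (b ∸ lo)) (λ _ → 1ℤ)
    ≡⟨ ones (b ∸ lo) ⟩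
  + (b ∸ lo)
    ≡⟨ cong +_ (trans (cong (_C 1) (ℕ.+-identityʳ (b ∸ lo))) (nC1≡n (b ∸ lo))) ⟨
  + ((b ∸ lo + 0) C 1) ∎
  where
  open ≡-Reasoning
  ones : ∀ u → ∑ (upTo u) (λ _ → 1ℤ) ≡ + u
  ones zero    = refl
  ones (suc u) = trans (∑-upTo-suc u (λ _ → 1ℤ)) (+-congʳ 1ℤ (ones u))
∑-staircase-from b (suc m) s s≤1 lo = begin
  ∑ (words (allFin b) (suc (suc m))) (λ z → ⟦ lo ℕ.≤? letters z zero ⟧ ℤ.* ⟦ staircase? s z ⟧)
    ≡⟨ ∑-words-suc (allFin b) (suc m) (λ z → ⟦ lo ℕ.≤? letters z zero ⟧ ℤ.* ⟦ staircase? s z ⟧) ⟩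
  ∑ (allFin b) (λ x → ∑ (words (allFin b) (suc m)) (λ z → ⟦ lo ℕ.≤? toℕ x ⟧ ℤ.* ⟦ staircase? s (x ∷ z) ⟧))
    ≡⟨ ∑-cong (allFin b) tails ⟩
  ∑ (allFin b) (λ x → ⟦ lo ℕ.≤? toℕ x ⟧ ℤ.* + ((b ∸ (toℕ x + s zero) + e) C suc m))
    ≡⟨ ∑-allFin b (λ x → ⟦ lo ℕ.≤? x ⟧ ℤ.* + ((b ∸ (x + s zero) + e) C suc m)) ⟩
  ∑ (upTo b) (λ x → ⟦ lo ℕ.≤? x ⟧ ℤ.* + ((b ∸ (x + s zero) + e) C suc m))
    ≡⟨ ∑-≥ b lo (λ x → + ((b ∸ (x + s zero) + e) C suc m)) ⟩
  ∑ (upTo (b ∸ lo)) (λ i → + ((b ∸ (lo + i + s zero) + e) C suc m))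
    ≡⟨ ∑-cong (upTo (b ∸ lo)) (λ i → cong (λ u → + ((u + e) C suc m)) (trans
         (cong (b ∸_) (ℕ.+-assoc lo i (s zero))) (sym (ℕ.∸-+-assoc b lo (i + s zero))))) ⟩
  ∑ (upTo (b ∸ lo)) (λ i → + ((b ∸ lo ∸ (i + s zero) + e) C suc m))
    ≡⟨ hockey-stick (s≤1 zero) e m (weakSteps-≤ (s ∘ suc)) (b ∸ lo) ⟩
  + ((b ∸ lo + weakSteps s) C suc (suc m)) ∎
  where
  open ≡-Reasoning
  e = weakSteps (s ∘ suc)
  tails : ∀ x → ∑ (words (allFin b) (suc m)) (λ z → ⟦ lo ℕ.≤? toℕ x ⟧ ℤ.* ⟦ staircase? s (x ∷ z) ⟧) ≡
                ⟦ lo ℕ.≤? toℕ x ⟧ ℤ.* + ((b ∸ (toℕ x + s zero) + e) C suc m)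
  tails x = trans
    (∑-*ˡ (words (allFin b) (suc m)) ⟦ lo ℕ.≤? toℕ x ⟧ (λ z → ⟦ staircase? s (x ∷ z) ⟧))
    (cong (λ t → ⟦ lo ℕ.≤? toℕ x ⟧ ℤ.* t) (trans
      (∑-cong (words (allFin b) (suc m)) (λ { (y ∷ v) → staircase-∷ s x y v }))
      (∑-staircase-from b m (s ∘ suc) (s≤1 ∘ suc) (toℕ x + s zero))))

drop-≤1 : ∀ p y → drop p y ≤ 1
drop-≤1 p y with y ℕ.<ᵇ p
... | true  = ℕ.≤-refl
... | false = z≤n

∑-staircase : ∀ b m (s : Fin m → ℕ) → (∀ i → s i ≤ 1) →
  ∑ (words (allFin b) (suc m)) (λ z → ⟦ staircase? s z ⟧) ≡ + ((b + weakSteps s) C suc m)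
∑-staircase b m s s≤1 = trans
  (∑-cong (words (allFin b) (suc m)) (λ z → sym (ℤ.*-identityˡ ⟦ staircase? s z ⟧)))
  (∑-staircase-from b m s s≤1 0)

weakSteps-+ : (s : Fin m → ℕ) → (∀ i → s i ≤ 1) → + weakSteps s ℤ.+ ∑ (allFin m) (λ i → + s i) ≡ + m
weakSteps-+ {zero}  s s≤1 = refl
weakSteps-+ {suc m} s s≤1 = begin
  + (1 ∸ s zero + w) ℤ.+ ∑ (allFin (suc m)) (λ i → + s i)
    ≡⟨ cong₂ ℤ._+_ (ℤ.pos-+ (1 ∸ s zero) w) (∑-allFin-suc m (λ i → + s i)) ⟩
  + (1 ∸ s zero) ℤ.+ + w ℤ.+ (+ s zero ℤ.+ ∑ (allFin m) (λ i → + s (suc i)))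
    ≡⟨ regroup (+ (1 ∸ s zero)) (+ w) (+ s zero) (∑ (allFin m) (λ i → + s (suc i))) ⟩
  + (1 ∸ s zero) ℤ.+ + s zero ℤ.+ (+ w ℤ.+ ∑ (allFin m) (λ i → + s (suc i)))
    ≡⟨ cong₂ ℤ._+_ (trans (sym (ℤ.pos-+ (1 ∸ s zero) (s zero))) (cong +_ (ℕ.m∸n+n≡m (s≤1 zero))))
                   (weakSteps-+ (s ∘ suc) (s≤1 ∘ suc)) ⟩
  + suc m ∎
  where
  open ≡-Reasoning
  w = weakSteps (s ∘ suc)
  regroup : ∀ a b c d → a ℤ.+ b ℤ.+ (c ℤ.+ d) ≡ a ℤ.+ c ℤ.+ (b ℤ.+ d)
  regroup = solve-∀

∑-rises : (τ : Permutation′ (suc m)) → ∑ (allFin m) (λ i → + rises τ i) ≡ + descents τ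
∑-rises {m} τ = trans
  (∑-cong (allFin m) (λ i → drop≡⟦⟧ (toℕ (τ ⟨$⟩ʳ inject₁ i)) (toℕ (τ ⟨$⟩ʳ suc i))))
  (sym (length-filter≡∑ (λ i → (τ ⟨$⟩ʳ suc i) Fin.<? (τ ⟨$⟩ʳ inject₁ i)) (allFin m)))

∑-words-standardizes : ∀ b (σ : Permutation′ (suc m)) →
  ∑ (words (allFin b) (suc m)) (λ y → ⟦ standardizes? σ (letters y) ⟧) ≡
  binom (+ suc m ℤ.+ + b ℤ.- + descents (flip σ) ℤ.- 1ℤ) (suc m)
∑-words-standardizes {m} b σ = begin
  ∑ (words (allFin b) (suc m)) (λ y → ⟦ standardizes? σ (letters y) ⟧)
    ≡⟨ ∑-standardizes≡∑-staircase b σ ⟩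
  ∑ (words (allFin b) (suc m)) (λ z → ⟦ staircase? s z ⟧)
    ≡⟨ ∑-staircase b m s s≤1 ⟩
  + ((b + w) C suc m)
    ≡⟨ cong (λ u → binom u (suc m)) top ⟩
  binom (+ suc m ℤ.+ + b ℤ.- + d ℤ.- 1ℤ) (suc m) ∎
  where
  open ≡-Reasoning
  s = rises (flip σ)
  d = descents (flip σ)
  w = weakSteps s
  s≤1 : ∀ i → s i ≤ 1
  s≤1 i = drop-≤1 (toℕ (flip σ ⟨$⟩ʳ inject₁ i)) (toℕ (flip σ ⟨$⟩ʳ suc i))
  regroup : ∀ b w d → b ℤ.+ w ≡ 1ℤ ℤ.+ (w ℤ.+ d) ℤ.+ b ℤ.- d ℤ.- 1ℤ
  regroup = solve-∀
  -- Of the `m` steps, `d` are strict, so `w` is `m - d`.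
  top : + (b + w) ≡ + suc m ℤ.+ + b ℤ.- + d ℤ.- 1ℤ
  top = begin
    + (b + w)                                      ≡⟨ ℤ.pos-+ b w ⟩
    + b ℤ.+ + w                                    ≡⟨ regroup (+ b) (+ w) (+ d) ⟩
    1ℤ ℤ.+ (+ w ℤ.+ + d) ℤ.+ + b ℤ.- + d ℤ.- 1ℤ
      ≡⟨ cong (λ u → 1ℤ ℤ.+ u ℤ.+ + b ℤ.- + d ℤ.- 1ℤ)
           (trans (+-congʳ (+ w) (sym (∑-rises (flip σ)))) (weakSteps-+ s s≤1)) ⟩
    + suc m ℤ.+ + b ℤ.- + d ℤ.- 1ℤ                 ∎

-- Double counting of the pairs of a word and its standardization: the words are grouped by `σ`,
-- whose number of descents is that of the word.
∑-wordDescents : ∀ m b (F : ℕ → ℤ) →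
  ∑ (words (allFin b) (suc m)) (F ∘ wordDescents 0) ≡
  ∑ (permutations (suc m)) (λ σ →
    F (descents σ) ℤ.* binom (+ suc m ℤ.+ + b ℤ.- + descents (flip σ) ℤ.- 1ℤ) (suc m))
∑-wordDescents m b F = begin
  ∑ ws (F ∘ wordDescents 0)
    ≡⟨ ∑-cong ws (λ y → trans
         (cong (ℤ._* F (wordDescents 0 y)) (∑-standardizes (suc m) (letters y)))
         (ℤ.*-identityˡ (F (wordDescents 0 y)))) ⟨
  ∑ ws (λ y → ∑ ps (λ σ → ⟦ standardizes? σ (letters y) ⟧) ℤ.* F (wordDescents 0 y))
    ≡⟨ ∑-cong ws (λ y → ∑-*ʳ ps (F (wordDescents 0 y)) (λ σ → ⟦ standardizes? σ (letters y) ⟧)) ⟨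
  ∑ ws (λ y → ∑ ps (λ σ → ⟦ standardizes? σ (letters y) ⟧ ℤ.* F (wordDescents 0 y)))
    ≡⟨ ∑-comm ws ps (λ y σ → ⟦ standardizes? σ (letters y) ⟧ ℤ.* F (wordDescents 0 y)) ⟩
  ∑ ps (λ σ → ∑ ws (λ y → ⟦ standardizes? σ (letters y) ⟧ ℤ.* F (wordDescents 0 y)))
    ≡⟨ ∑-cong ps (λ σ → ∑-cong ws (λ y → trans
         (⟦⟧-*-cong (standardizes? σ (letters y)) (λ std → cong F (sym (descents-standardization σ y std))))
         (ℤ.*-comm ⟦ standardizes? σ (letters y) ⟧ (F (descents σ))))) ⟩
  ∑ ps (λ σ → ∑ ws (λ y → F (descents σ) ℤ.* ⟦ standardizes? σ (letters y) ⟧))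
    ≡⟨ ∑-cong ps (λ σ → trans
         (∑-*ˡ ws (F (descents σ)) (λ y → ⟦ standardizes? σ (letters y) ⟧))
         (cong (F (descents σ) ℤ.*_) (∑-words-standardizes b σ))) ⟩
  ∑ ps (λ σ → F (descents σ) ℤ.* binom (+ suc m ℤ.+ + b ℤ.- + descents (flip σ) ℤ.- 1ℤ) (suc m)) ∎
  where
  open ≡-Reasoning
  ws = words (allFin b) (suc m)
  ps = permutations (suc m)

-- The transition matrix

∸-comm : ∀ m n o → m ∸ n ∸ o ≡ m ∸ o ∸ n
∸-comm m n o = trans (ℕ.∸-+-assoc m n o) (trans (cong (m ∸_) (ℕ.+-comm n o)) (sym (ℕ.∸-+-assoc m o n)))

module _ (b : ℕ) where

  ∇ : (ℕ → ℤ) → ℕ → ℤ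
  ∇ f s = f s ℤ.- f (s ∸ b)

  ∇^ : ℕ → (ℕ → ℤ) → ℕ → ℤ
  ∇^ zero    f = f
  ∇^ (suc N) f = ∇ (∇^ N f)

  ∇-cong : ∀ {f g} → (∀ s → f s ≡ g s) → ∀ s → ∇ f s ≡ ∇ g s
  ∇-cong e s = cong₂ ℤ._-_ (e s) (e (s ∸ b))

  ∇^-cong : ∀ N {f g} → (∀ s → f s ≡ g s) → ∀ s → ∇^ N f s ≡ ∇^ N g s
  ∇^-cong zero    e = e
  ∇^-cong (suc N) e = ∇-cong (∇^-cong N e)

  ∇^-∇ : ∀ N f s → ∇^ N (∇ f) s ≡ ∇^ (suc N) f s
  ∇^-∇ zero    f s = refl
  ∇^-∇ (suc N) f s = ∇-cong (∇^-∇ N f) s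

  -- If `f s` counts tuples with sum below `s`, then `window f s` counts tuples with one further
  -- entry, taken from the digits below `b`.
  window : (ℕ → ℤ) → ℕ → ℤ
  window f s = ∑ (upTo b) (λ x → f (s ∸ x))

  -- Both operators are combinations of truncated shifts, and these commute.
  window-∇^ : ∀ N f s → window (∇^ N f) s ≡ ∇^ N (window f) s
  window-∇^ zero    f s = refl
  window-∇^ (suc N) f s = begin
    ∑ (upTo b) (λ x → g (s ∸ x) ℤ.- g (s ∸ x ∸ b))
      ≡⟨ ∑-- (upTo b) (λ x → g (s ∸ x)) (λ x → g (s ∸ x ∸ b)) ⟩
    window g s ℤ.- ∑ (upTo b) (λ x → g (s ∸ x ∸ b))
      ≡⟨ cong (λ t → window g s ℤ.- t) (∑-cong (upTo b) (λ x → cong g (∸-comm s x b))) ⟩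
    ∇ (window g) s
      ≡⟨ ∇-cong (window-∇^ N f) s ⟩
    ∇^ (suc N) (window f) s ∎
    where
    open ≡-Reasoning
    g = ∇^ N f

-- The coefficient of `x^l` in `(1 - x)^N`.
coeff : ℕ → ℕ → ℤ
coeff N l = -1ℤ ℤ.^ l ℤ.* + (N C l)

coeff-suc : ∀ N l → coeff (suc N) (suc l) ≡ coeff N (suc l) ℤ.- coeff N l
coeff-suc N l = begin
  -1ℤ ℤ.* p ℤ.* + (suc N C suc l)                             ≡⟨ cong (λ c → -1ℤ ℤ.* p ℤ.* c) (pascal N l) ⟩
  -1ℤ ℤ.* p ℤ.* (+ (N C l) ℤ.+ + (N C suc l))                 ≡⟨ expand -1ℤ p (+ (N C l)) (+ (N C suc l)) ⟩
  -1ℤ ℤ.* p ℤ.* + (N C suc l) ℤ.+ -1ℤ ℤ.* (p ℤ.* + (N C l))   ≡⟨ +-congʳ (coeff N (suc l)) (ℤ.-1*i≡-i (coeff N l)) ⟩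
  coeff N (suc l) ℤ.- coeff N l                               ∎
  where
  open ≡-Reasoning
  p = -1ℤ ℤ.^ l
  expand : ∀ u p a c → u ℤ.* p ℤ.* (a ℤ.+ c) ≡ u ℤ.* p ℤ.* c ℤ.+ u ℤ.* (p ℤ.* a)
  expand = solve-∀

-- One more factor `1 - x`. Shifting the index pushes one term past the cutoff `M`, a multiple of
-- `g M`, which is 0.
∑-coeff-suc : ∀ N M (g : ℕ → ℤ) → g M ≡ 0ℤ →
  ∑ (upTo M) (λ l → coeff (suc N) l ℤ.* g l) ≡
  ∑ (upTo M) (λ l → coeff N l ℤ.* g l) ℤ.- ∑ (upTo M) (λ l → coeff N l ℤ.* g (suc l))
∑-coeff-suc N zero    g gM≡0 = refl
∑-coeff-suc N (suc M) g gM≡0 = begin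
  ∑ (upTo (suc M)) (λ l → coeff (suc N) l ℤ.* g l)
    ≡⟨ ∑-upTo-suc M (λ l → coeff (suc N) l ℤ.* g l) ⟩
  h ℤ.+ ∑ (upTo M) (λ l → coeff (suc N) (suc l) ℤ.* g (suc l))
    ≡⟨ +-congʳ h (∑-cong (upTo M) (λ l → trans
         (cong (ℤ._* g (suc l)) (coeff-suc N l)) (distrib (coeff N (suc l)) (coeff N l) (g (suc l))))) ⟩
  h ℤ.+ ∑ (upTo M) (λ l → coeff N (suc l) ℤ.* g (suc l) ℤ.- coeff N l ℤ.* g (suc l))
    ≡⟨ +-congʳ h (∑-- (upTo M) (λ l → coeff N (suc l) ℤ.* g (suc l)) (λ l → coeff N l ℤ.* g (suc l))) ⟩
  h ℤ.+ (X ℤ.- Y)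
    ≡⟨ ℤ.+-assoc h X (ℤ.- Y) ⟨
  h ℤ.+ X ℤ.- Y
    ≡⟨ cong₂ ℤ._-_ (sym (∑-upTo-suc M (λ l → coeff N l ℤ.* g l))) (sym last) ⟩
  ∑ (upTo (suc M)) (λ l → coeff N l ℤ.* g l) ℤ.- ∑ (upTo (suc M)) (λ l → coeff N l ℤ.* g (suc l)) ∎
  where
  open ≡-Reasoning
  h = coeff N 0 ℤ.* g 0
  X = ∑ (upTo M) (λ l → coeff N (suc l) ℤ.* g (suc l))
  Y = ∑ (upTo M) (λ l → coeff N l ℤ.* g (suc l))
  distrib : ∀ a c x → (a ℤ.- c) ℤ.* x ≡ a ℤ.* x ℤ.- c ℤ.* x
  distrib = solve-∀
  last : ∑ (upTo (suc M)) (λ l → coeff N l ℤ.* g (suc l)) ≡ Y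
  last = begin
    ∑ (upTo (suc M)) (λ l → coeff N l ℤ.* g (suc l))
      ≡⟨ cong (λ k → ∑ (upTo k) (λ l → coeff N l ℤ.* g (suc l))) (ℕ.+-comm 1 M) ⟩
    ∑ (upTo (M + 1)) (λ l → coeff N l ℤ.* g (suc l))
      ≡⟨ ∑-upTo-+ M 1 (λ l → coeff N l ℤ.* g (suc l)) ⟩
    Y ℤ.+ (coeff N (M + 0) ℤ.* g (suc (M + 0)) ℤ.+ 0ℤ)
      ≡⟨ cong (λ k → Y ℤ.+ (coeff N k ℤ.* g (suc k) ℤ.+ 0ℤ)) (ℕ.+-identityʳ M) ⟩
    Y ℤ.+ (coeff N M ℤ.* g (suc M) ℤ.+ 0ℤ)
      ≡⟨ cong (λ z → Y ℤ.+ (coeff N M ℤ.* z ℤ.+ 0ℤ)) gM≡0 ⟩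
    Y ℤ.+ (coeff N M ℤ.* 0ℤ ℤ.+ 0ℤ)
      ≡⟨ cong (λ z → Y ℤ.+ (z ℤ.+ 0ℤ)) (ℤ.*-zeroʳ (coeff N M)) ⟩
    Y ℤ.+ 0ℤ
      ≡⟨ ℤ.+-identityʳ Y ⟩
    Y ∎

-- The binomial expansion of a power of `1 - shift`. `M` terms suffice since `s ≤ M * b` makes every
-- later argument `s ∸ l * b` equal to 0, where `f` vanishes; the same `M` serves all `N`.
∇^-expand : ∀ b f → f 0 ≡ 0ℤ → ∀ N M s → s ≤ M * b →
            ∇^ b N f s ≡ ∑ (upTo M) (λ l → coeff N l ℤ.* f (s ∸ l * b))
∇^-expand b f f0≡0 zero    zero    s s≤0 rewrite ℕ.n≤0⇒n≡0 s≤0 = f0≡0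
∇^-expand b f f0≡0 zero    (suc M) s _   = sym (begin
  ∑ (upTo (suc M)) (λ l → coeff 0 l ℤ.* f (s ∸ l * b))
    ≡⟨ ∑-upTo-suc M (λ l → coeff 0 l ℤ.* f (s ∸ l * b)) ⟩
  1ℤ ℤ.* f s ℤ.+ ∑ (upTo M) (λ l → coeff 0 (suc l) ℤ.* f (s ∸ suc l * b))
    ≡⟨ cong₂ ℤ._+_ (ℤ.*-identityˡ (f s)) (∑-zero (upTo M) (λ l → cong (ℤ._* f (s ∸ suc l * b))
         (trans (cong (λ c → -1ℤ ℤ.^ suc l ℤ.* + c) (k>n⇒nCk≡0 {0} {suc l} (s≤s z≤n))) (ℤ.*-zeroʳ (-1ℤ ℤ.^ suc l))))) ⟩
  f s ℤ.+ 0ℤ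
    ≡⟨ ℤ.+-identityʳ (f s) ⟩
  f s ∎)
  where open ≡-Reasoning
∇^-expand b f f0≡0 (suc N) M s s≤Mb = begin
  ∇^ b N f s ℤ.- ∇^ b N f (s ∸ b)
    ≡⟨ cong₂ ℤ._-_ (∇^-expand b f f0≡0 N M s s≤Mb)
         (∇^-expand b f f0≡0 N M (s ∸ b) (ℕ.≤-trans (ℕ.m∸n≤m s b) s≤Mb)) ⟩
  ∑ (upTo M) (λ l → coeff N l ℤ.* f (s ∸ l * b)) ℤ.- ∑ (upTo M) (λ l → coeff N l ℤ.* f (s ∸ b ∸ l * b))
    ≡⟨ cong (λ t → ∑ (upTo M) (λ l → coeff N l ℤ.* f (s ∸ l * b)) ℤ.- t)
         (∑-cong (upTo M) (λ l → cong (λ t → coeff N l ℤ.* f t) (ℕ.∸-+-assoc s b (l * b)))) ⟩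
  ∑ (upTo M) (λ l → coeff N l ℤ.* f (s ∸ l * b)) ℤ.- ∑ (upTo M) (λ l → coeff N l ℤ.* f (s ∸ suc l * b))
    ≡⟨ ∑-coeff-suc N M (λ l → f (s ∸ l * b)) (trans (cong f (ℕ.m≤n⇒m∸n≡0 s≤Mb)) f0≡0) ⟨
  ∑ (upTo M) (λ l → coeff (suc N) l ℤ.* f (s ∸ l * b)) ∎
  where open ≡-Reasoning

-- The number of k-tuples of naturals with sum less than s. It vanishes at s = 0, so
-- the truncated shifts s ∸ x give the value 0 that negative arguments should have.
simplex : ℕ → ℕ → ℤ
simplex k zero    = 0ℤ
simplex k (suc s) = + ((s + k) C k)

-- Splits the tuples of length `suc k` by one entry: either it is 0, or lowering it by 1 leaves a
-- tuple with sum below `s ∸ 1`.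
simplex-suc : ∀ k s → simplex (suc k) s ≡ simplex k s ℤ.+ simplex (suc k) (s ∸ 1)
simplex-suc k zero          = refl
simplex-suc k (suc zero)    =
  trans (pascal k k) (cong (λ c → + (k C k) ℤ.+ + c) (k>n⇒nCk≡0 (ℕ.n<1+n k)))
simplex-suc k (suc (suc s)) = trans (pascal (s + suc k) k)
  (cong (λ t → + (t C k) ℤ.+ + ((s + suc k) C suc k)) (ℕ.+-suc s k))

-- `simplex-suc` telescoped over `b` steps: the entries below `b` are all entries without those from
-- `b` on.
window-simplex : ∀ b k s → window b (simplex k) s ≡ ∇ b (simplex (suc k)) s
window-simplex zero    k s = sym (ℤ.+-inverseʳ (simplex (suc k) s))
window-simplex (suc b) k s = begin
  ∑ (upTo (suc b)) (λ x → simplex k (s ∸ x))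
    ≡⟨ ∑-upTo-suc b (λ x → simplex k (s ∸ x)) ⟩
  simplex k s ℤ.+ ∑ (upTo b) (λ x → simplex k (s ∸ suc x))
    ≡⟨ +-congʳ (simplex k s) (∑-cong (upTo b) (λ x → cong (simplex k) (sym (ℕ.∸-+-assoc s 1 x)))) ⟩
  simplex k s ℤ.+ window b (simplex k) (s ∸ 1)
    ≡⟨ +-congʳ (simplex k s) (window-simplex b k (s ∸ 1)) ⟩
  simplex k s ℤ.+ (simplex (suc k) (s ∸ 1) ℤ.- simplex (suc k) (s ∸ 1 ∸ b))
    ≡⟨ ℤ.+-assoc (simplex k s) (simplex (suc k) (s ∸ 1)) (ℤ.- simplex (suc k) (s ∸ 1 ∸ b)) ⟨
  simplex k s ℤ.+ simplex (suc k) (s ∸ 1) ℤ.- simplex (suc k) (s ∸ 1 ∸ b)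
    ≡⟨ cong₂ (λ x t → x ℤ.- simplex (suc k) t) (sym (simplex-suc k s)) (ℕ.∸-+-assoc s 1 b) ⟩
  ∇ (suc b) (simplex (suc k)) s ∎
  where open ≡-Reasoning

+<⇒<∸ : ∀ i {t m} → i + t < m → t < m ∸ i
+<⇒<∸ zero    lt       = lt
+<⇒<∸ (suc i) (s≤s lt) = +<⇒<∸ i lt

<∸⇒+< : ∀ i {t m} → t < m ∸ i → i + t < m
<∸⇒+< zero            lt = lt
<∸⇒+< (suc i) {m = suc m} lt = s≤s (<∸⇒+< i lt)

-- Each digit contributes one window, a window of `simplex k` is a difference of `simplex (suc k)`,
-- and the differences collect outside.
∑ᵈ-< : ∀ b k s → ∑ᵈ k b (λ t → ⟦ t ℕ.<? s ⟧) ≡ ∇^ b k (simplex k) s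
∑ᵈ-< b zero    zero    = refl
∑ᵈ-< b zero    (suc s) = refl
∑ᵈ-< b (suc k) s = begin
  ∑ᵈ (suc k) b (λ t → ⟦ t ℕ.<? s ⟧)
    ≡⟨ ∑ᵈ-suc k b (λ t → ⟦ t ℕ.<? s ⟧) ⟩
  ∑ (upTo b) (λ x → ∑ᵈ k b (λ t → ⟦ x + t ℕ.<? s ⟧))
    ≡⟨ ∑-cong (upTo b) (λ x → ∑ᵈ-cong k b (λ t →
         ⟦⟧-cong (x + t ℕ.<? s) (t ℕ.<? s ∸ x) (+<⇒<∸ x) (<∸⇒+< x))) ⟩
  ∑ (upTo b) (λ x → ∑ᵈ k b (λ t → ⟦ t ℕ.<? s ∸ x ⟧))
    ≡⟨ ∑-cong (upTo b) (λ x → ∑ᵈ-< b k (s ∸ x)) ⟩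
  window b (∇^ b k (simplex k)) s
    ≡⟨ window-∇^ b k (simplex k) s ⟩
  ∇^ b k (window b (simplex k)) s
    ≡⟨ ∇^-cong b k (window-simplex b k) s ⟩
  ∇^ b k (∇ b (simplex (suc k))) s
    ≡⟨ ∇^-∇ b k (simplex (suc k)) s ⟩
  ∇^ b (suc k) (simplex (suc k)) s ∎
  where open ≡-Reasoning

⟦≟⟧-telescope : ∀ q j → ⟦ q ℕ.≟ j ⟧ ≡ ⟦ q ℕ.<? suc j ⟧ ℤ.- ⟦ q ℕ.<? j ⟧
⟦≟⟧-telescope q j = go (q ℕ.<? j) (q ℕ.≟ j)
  where
  go : (lt? : Dec (q < j)) (eq? : Dec (q ≡ j)) → ⟦ eq? ⟧ ≡ ⟦ q ℕ.<? suc j ⟧ ℤ.- ⟦ lt? ⟧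
  go (yes lt) (yes e) = contradiction e (ℕ.<⇒≢ lt)
  go (yes lt) (no _)  = sym (cong (ℤ._- 1ℤ) (⟦⟧-true (q ℕ.<? suc j) (ℕ.m<n⇒m<1+n lt)))
  go (no _)   (yes e) = sym (cong (ℤ._- 0ℤ) (⟦⟧-true (q ℕ.<? suc j) (s≤s (ℕ.≤-reflexive e))))
  go (no ≮)   (no ≢)  = sym (cong (ℤ._- 0ℤ) (⟦⟧-false (q ℕ.<? suc j)
    (λ lt → [ ≮ , ≢ ]′ (ℕ.m≤n⇒m<n∨m≡n (s≤s⁻¹ lt)))))

⟦/<⟧ : ∀ i t b .{{_ : NonZero b}} m → ⟦ (i + t) / b ℕ.<? m ⟧ ≡ ⟦ t ℕ.<? m * b ∸ i ⟧
⟦/<⟧ i t b m = ⟦⟧-cong ((i + t) / b ℕ.<? m) (t ℕ.<? m * b ∸ i)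
  (λ lt → +<⇒<∸ i (ℕ.≰⇒> (λ le → ℕ.<⇒≱ lt (subst (_≤ (i + t) / b) (m*n/n≡m m b) (/-monoˡ-≤ b le)))))
  (λ lt → m<n*o⇒m/o<n (<∸⇒+< i lt))

-- A carry equal to `j` is below `suc j` but not below `j`. The two resulting bounds on the digit
-- sum differ by a shift by `b`, which adds one difference to the `n` coming from the digits: hence
-- `suc n` in the binomial coefficients of `P`.
∑ᵈ-/≟ : ∀ n b .{{_ : NonZero b}} i j →
        ∑ᵈ n b (λ s → ⟦ (i + s) / b ℕ.≟ j ⟧) ≡ ∇^ b (suc n) (simplex n) (suc j * b ∸ i)
∑ᵈ-/≟ n b i j = begin
  ∑ᵈ n b (λ s → ⟦ (i + s) / b ℕ.≟ j ⟧)
    ≡⟨ ∑ᵈ-cong n b (λ s → trans (⟦≟⟧-telescope ((i + s) / b) j)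
         (cong₂ ℤ._-_ (⟦/<⟧ i s b (suc j)) (⟦/<⟧ i s b j))) ⟩
  ∑ᵈ n b (λ s → ⟦ s ℕ.<? suc j * b ∸ i ⟧ ℤ.- ⟦ s ℕ.<? j * b ∸ i ⟧)
    ≡⟨ ∑-- (words (allFin b) n) (λ x → ⟦ digitSum x ℕ.<? suc j * b ∸ i ⟧) (λ x → ⟦ digitSum x ℕ.<? j * b ∸ i ⟧) ⟩
  ∑ᵈ n b (λ s → ⟦ s ℕ.<? suc j * b ∸ i ⟧) ℤ.- ∑ᵈ n b (λ s → ⟦ s ℕ.<? j * b ∸ i ⟧)
    ≡⟨ cong₂ ℤ._-_ (∑ᵈ-< b n (suc j * b ∸ i)) (trans (∑ᵈ-< b n (j * b ∸ i)) (cong (∇^ b n (simplex n)) below)) ⟩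
  ∇^ b (suc n) (simplex n) (suc j * b ∸ i) ∎
  where
  open ≡-Reasoning
  below : j * b ∸ i ≡ suc j * b ∸ i ∸ b
  below = trans (cong (_∸ i) (sym (ℕ.m+n∸m≡n b (j * b)))) (∸-comm (b + j * b) b i)

binom-< : ∀ z k → z ℤ.< + k → binom z k ≡ 0ℤ
binom-< (+ m)    k lt = cong +_ (k>n⇒nCk≡0 (ℤ.drop‿+<+ lt))
binom-< -[1+ _ ] k lt = refl

-- The truncation matches the convention of `binom`: with `T` and `U` as below, `T ≤ U` puts the
-- upper index below `n`, and otherwise it is `d + n`, where `T ∸ U` is `suc d`.
simplex≡binom : ∀ n b i j l →
  simplex n (suc j * b ∸ i ∸ l * b) ≡
  binom (+ n ℤ.- 1ℤ ℤ.- + i ℤ.+ (+ j ℤ.+ 1ℤ ℤ.- + l) ℤ.* + b) n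
simplex≡binom n b i j l = trans (trans (cong (simplex n) (ℕ.∸-+-assoc T i (l * b))) (go (ℕ.<-≤-connex U T)))
                                (cong (λ z → binom z n) (sym top))
  where
  open ≡-Reasoning
  T = suc j * b
  U = i + l * b
  regroup : ∀ n i j l b → n ℤ.- 1ℤ ℤ.- i ℤ.+ (j ℤ.+ 1ℤ ℤ.- l) ℤ.* b ≡
                          n ℤ.- 1ℤ ℤ.+ ((1ℤ ℤ.+ j) ℤ.* b ℤ.- (i ℤ.+ l ℤ.* b))
  regroup = solve-∀
  top : + n ℤ.- 1ℤ ℤ.- + i ℤ.+ (+ j ℤ.+ 1ℤ ℤ.- + l) ℤ.* + b ≡ + n ℤ.- 1ℤ ℤ.+ (+ T ℤ.- + U)
  top = trans (regroup (+ n) (+ i) (+ j) (+ l) (+ b)) (sym (cong₂ (λ x y → + n ℤ.- 1ℤ ℤ.+ (x ℤ.- y))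
    (ℤ.pos-* (suc j) b) (trans (ℤ.pos-+ i (l * b)) (+-congʳ (+ i) (ℤ.pos-* l b)))))
  above : ∀ d → + n ℤ.- 1ℤ ℤ.+ (+ (suc d + U) ℤ.- + U) ≡ + (d + n)
  above d = trans (cong (λ z → + n ℤ.- 1ℤ ℤ.+ (z ℤ.- + U)) (ℤ.pos-+ (suc d) U))
    (trans (ring (+ n) (+ d) (+ U)) (sym (ℤ.pos-+ d n)))
    where
    ring : ∀ n d u → n ℤ.- 1ℤ ℤ.+ (1ℤ ℤ.+ d ℤ.+ u ℤ.- u) ≡ d ℤ.+ n
    ring = solve-∀
  below : T ≤ U → + n ℤ.- 1ℤ ℤ.+ (+ T ℤ.- + U) ℤ.< + n
  below T≤U = ℤ.≤-<-trans
    (subst (+ n ℤ.- 1ℤ ℤ.+ (+ T ℤ.- + U) ℤ.≤_) (ℤ.+-identityʳ (+ n ℤ.- 1ℤ))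
      (ℤ.+-monoʳ-≤ (+ n ℤ.- 1ℤ) (ℤ.i≤j⇒i-j≤0 (ℤ.+≤+ T≤U))))
    (subst (+ n ℤ.- 1ℤ ℤ.<_) (ℤ.+-identityʳ (+ n)) (ℤ.+-monoʳ-< (+ n) ℤ.-<+))
  go : U < T ⊎ T ≤ U → simplex n (T ∸ U) ≡ binom (+ n ℤ.- 1ℤ ℤ.+ (+ T ℤ.- + U)) n
  go (inj₂ T≤U) = trans (cong (simplex n) (ℕ.m≤n⇒m∸n≡0 T≤U)) (sym (binom-< _ n (below T≤U)))
  go (inj₁ U<T) with T ∸ U | ℕ.m<n⇒0<n∸m U<T | ℕ.m∸n+n≡m (ℕ.<⇒≤ U<T)
  ... | suc d | _ | e = cong (λ z → binom z n)
    (trans (sym (above d)) (cong (λ t → + n ℤ.- 1ℤ ℤ.+ (+ t ℤ.- + U)) e))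

∑ᵈ-transition : ∀ n b .{{_ : NonZero b}} i j →
  ∑ᵈ n b (λ s → ⟦ (i + s) / b ℕ.≟ j ⟧) ≡
  ∑ (upTo (suc j ∸ i / b)) (λ l →
    -1ℤ ℤ.^ l ℤ.* binom (+ suc n) l ℤ.* binom (+ n ℤ.- 1ℤ ℤ.- + i ℤ.+ (+ j ℤ.+ 1ℤ ℤ.- + l) ℤ.* + b) n)
∑ᵈ-transition n b i j = begin
  ∑ᵈ n b (λ s → ⟦ (i + s) / b ℕ.≟ j ⟧)
    ≡⟨ ∑ᵈ-/≟ n b i j ⟩
  ∇^ b (suc n) (simplex n) (suc j * b ∸ i)
    ≡⟨ ∇^-expand b (simplex n) refl (suc n) M (suc j * b ∸ i) bound ⟩
  ∑ (upTo M) (λ l → coeff (suc n) l ℤ.* simplex n (suc j * b ∸ i ∸ l * b))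
    ≡⟨ ∑-cong (upTo M) (λ l → cong (coeff (suc n) l ℤ.*_) (simplex≡binom n b i j l)) ⟩
  ∑ (upTo M) (λ l →
    coeff (suc n) l ℤ.* binom (+ n ℤ.- 1ℤ ℤ.- + i ℤ.+ (+ j ℤ.+ 1ℤ ℤ.- + l) ℤ.* + b) n) ∎
  where
  open ≡-Reasoning
  M = suc j ∸ i / b
  -- Rounding `i` down to a multiple of `b` only enlarges the difference, so `M` shifts by `b`
  -- exhaust it.
  bound : suc j * b ∸ i ≤ M * b
  bound = subst (suc j * b ∸ i ≤_) (sym (ℕ.*-distribʳ-∸ b (suc j) (i / b)))
            (ℕ.∸-monoʳ-≤ (suc j * b) (m/n*n≤m i b))

-- Probabilities

/-+ : ∀ p q d .{{_ : NonZero d}} → (p ℚ./ d) ℚ.+ (q ℚ./ d) ≡ (p ℤ.+ q) ℚ./ d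
/-+ p q (suc d) = ℚ.toℚᵘ-injective (begin
  toℚᵘ ((p ℚ./ suc d) ℚ.+ (q ℚ./ suc d))         ≈⟨ ℚ.toℚᵘ-homo-+ (p ℚ./ suc d) (q ℚ./ suc d) ⟩
  toℚᵘ (p ℚ./ suc d) ℚᵘ.+ toℚᵘ (q ℚ./ suc d)     ≈⟨ ℚᵘ.+-cong (ℚ.toℚᵘ-fromℚᵘ (mkℚᵘ p d)) (ℚ.toℚᵘ-fromℚᵘ (mkℚᵘ q d)) ⟩
  mkℚᵘ p d ℚᵘ.+ mkℚᵘ q d                         ≈⟨ *≡* (trans (common p q (+ suc d)) (cong ((p ℤ.+ q) ℤ.*_) (sym (ℤ.pos-* (suc d) (suc d))))) ⟩
  mkℚᵘ (p ℤ.+ q) d                               ≈⟨ ℚ.toℚᵘ-fromℚᵘ (mkℚᵘ (p ℤ.+ q) d) ⟨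
  toℚᵘ ((p ℤ.+ q) ℚ./ suc d)                     ∎)
  where
  open ℚᵘ.≃-Reasoning
  common : ∀ p q d → (p ℤ.* d ℤ.+ q ℤ.* d) ℤ.* d ≡ (p ℤ.+ q) ℤ.* (d ℤ.* d)
  common = solve-∀

/-* : ∀ p q c d .{{_ : NonZero c}} .{{_ : NonZero d}} .{{_ : NonZero (c * d)}} →
      (p ℚ./ c) ℚ.* (q ℚ./ d) ≡ (p ℤ.* q) ℚ./ (c * d)
/-* p q (suc c) (suc d) = ℚ.toℚᵘ-injective (begin
  toℚᵘ ((p ℚ./ suc c) ℚ.* (q ℚ./ suc d))         ≈⟨ ℚ.toℚᵘ-homo-* (p ℚ./ suc c) (q ℚ./ suc d) ⟩
  toℚᵘ (p ℚ./ suc c) ℚᵘ.* toℚᵘ (q ℚ./ suc d)     ≈⟨ ℚᵘ.*-cong (ℚ.toℚᵘ-fromℚᵘ (mkℚᵘ p c)) (ℚ.toℚᵘ-fromℚᵘ (mkℚᵘ q d)) ⟩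
  mkℚᵘ p c ℚᵘ.* mkℚᵘ q d                         ≈⟨ ℚ.toℚᵘ-fromℚᵘ (mkℚᵘ p c ℚᵘ.* mkℚᵘ q d) ⟨
  toℚᵘ ((p ℤ.* q) ℚ./ (suc c * suc d))           ∎)
  where open ℚᵘ.≃-Reasoning

sumℚ-/ : (xs : List A) (f : A → ℤ) (d : ℕ) .{{_ : NonZero d}} →
         sumℚ (map (λ x → f x ℚ./ d) xs) ≡ ∑ xs f ℚ./ d
sumℚ-/ []       f (suc d) = ℚ.fromℚᵘ-cong {mkℚᵘ 0ℤ 0} {mkℚᵘ 0ℤ d} (*≡* refl)
sumℚ-/ (x ∷ xs) f d       =
  trans (cong (λ t → (f x ℚ./ d) ℚ.+ t) (sumℚ-/ xs f d)) (/-+ (f x) (∑ xs f) d)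

-- Each digit is at most `b - 1`. Written additively, the bound combines with `i < n` to keep the
-- next carry below `n`.
digitSum-bound : ∀ {b n} (x : Vec (Fin b) n) → n + digitSum x ≤ n * b
digitSum-bound []                  = z≤n
digitSum-bound {b} {suc n} (d ∷ x) = begin
  suc n + (toℕ d + digitSum x)     ≡⟨ cong suc (ℕ.+-comm n (toℕ d + digitSum x)) ⟩
  suc (toℕ d + digitSum x + n)     ≡⟨ cong suc (ℕ.+-assoc (toℕ d) (digitSum x) n) ⟩
  suc (toℕ d) + (digitSum x + n)   ≡⟨ cong (λ t → suc (toℕ d) + t) (ℕ.+-comm (digitSum x) n) ⟩
  suc (toℕ d) + (n + digitSum x)   ≤⟨ ℕ.+-mono-≤ (Fin.toℕ<n d) (digitSum-bound x) ⟩
  b + n * b                        ∎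
  where open ℕ.≤-Reasoning

∑-allFin-select : ∀ {n q} → q < n → (g : ℕ → ℤ) →
                  ∑ (allFin n) (λ k → ⟦ q ℕ.≟ toℕ k ⟧ ℤ.* g (toℕ k)) ≡ g q
∑-allFin-select {n} {q} q<n g = begin
  ∑ (allFin n) (λ k → ⟦ q ℕ.≟ toℕ k ⟧ ℤ.* g (toℕ k))
    ≡⟨ ∑-cong (allFin n) (λ k → ⟦⟧-*-cong (q ℕ.≟ toℕ k) (cong g ∘ sym)) ⟩
  ∑ (allFin n) (λ k → ⟦ q ℕ.≟ toℕ k ⟧ ℤ.* g q)
    ≡⟨ ∑-*ʳ (allFin n) (g q) (λ k → ⟦ q ℕ.≟ toℕ k ⟧) ⟩
  ∑ (allFin n) (λ k → ⟦ q ℕ.≟ toℕ k ⟧) ℤ.* g q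
    ≡⟨ cong (ℤ._* g q) (∑-allFin-unique (λ k → q ℕ.≟ toℕ k) (fromℕ< q<n) (sym (Fin.toℕ-fromℕ< q<n))
         (λ k e → Fin.toℕ-injective (trans (sym e) (sym (Fin.toℕ-fromℕ< q<n))))) ⟩
  1ℤ ℤ.* g q
    ≡⟨ ℤ.*-identityˡ (g q) ⟩
  g q ∎
  where open ≡-Reasoning

-- Powers of the transition matrix as counts of digit tables

carryCount : (n b r : ℕ) .{{_ : NonZero b}} → ℕ → ℕ → ℤ
carryCount n b r k j = ∑ (words (words (allFin b) n) r) (λ X → ⟦ carry k X ℕ.≟ j ⟧)

-- The Chapman-Kolmogorov relation on counts, by the state after the first column. Summing over
-- `Fin n` loses no table, because a carry from `i < n` is again below `n`.
carryCount-suc : ∀ n b r .{{_ : NonZero b}} {i} j → i < n →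
  ∑ (allFin n) (λ k → ∑ᵈ n b (λ s → ⟦ (i + s) / b ℕ.≟ toℕ k ⟧) ℤ.* carryCount n b r (toℕ k) j) ≡
  carryCount n b (suc r) i j
carryCount-suc n b r {i} j i<n = begin
  ∑ (allFin n) (λ k → ∑ᵈ n b (λ s → ⟦ (i + s) / b ℕ.≟ toℕ k ⟧) ℤ.* g (toℕ k))
    ≡⟨ ∑-cong (allFin n) (λ k → ∑-*ʳ columns (g (toℕ k)) (λ x → ⟦ (i + digitSum x) / b ℕ.≟ toℕ k ⟧)) ⟨
  ∑ (allFin n) (λ k → ∑ᵈ n b (λ s → ⟦ (i + s) / b ℕ.≟ toℕ k ⟧ ℤ.* g (toℕ k)))
    ≡⟨ ∑-comm (allFin n) columns (λ k x → ⟦ (i + digitSum x) / b ℕ.≟ toℕ k ⟧ ℤ.* g (toℕ k)) ⟩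
  ∑ columns (λ x → ∑ (allFin n) (λ k → ⟦ (i + digitSum x) / b ℕ.≟ toℕ k ⟧ ℤ.* g (toℕ k)))
    ≡⟨ ∑-cong columns (λ x → ∑-allFin-select (state<n x) g) ⟩
  ∑ columns (λ x → g ((i + digitSum x) / b))
    ≡⟨ ∑-words-suc columns r (λ X → ⟦ carry i X ℕ.≟ j ⟧) ⟨
  carryCount n b (suc r) i j ∎
  where
  open ≡-Reasoning
  columns = words (allFin b) n
  g : ℕ → ℤ
  g k = carryCount n b r k j
  state<n : ∀ x → (i + digitSum x) / b < n
  state<n x = m<n*o⇒m/o<n (ℕ.<-≤-trans (ℕ.+-monoˡ-< (digitSum x) i<n) (digitSum-bound x))

P≡/ : ∀ n b .{{_ : NonZero b}} (i j : Fin n) →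
  P n b i j ≡ ℚ._/_ (∑ᵈ n b (λ s → ⟦ (toℕ i + s) / b ℕ.≟ toℕ j ⟧)) (b ^ n) {{m^n≢0 b n}}
P≡/ n b i j = cong (λ c → ℚ._/_ c (b ^ n) {{m^n≢0 b n}}) (sym (∑ᵈ-transition n b (toℕ i) (toℕ j)))

P^≡/ : ∀ n b r .{{_ : NonZero b}} (i j : Fin n) →
  (P n b ^ᴹ r) i j ≡
  ℚ._/_ (carryCount n b r (toℕ i) (toℕ j)) ((b ^ n) ^ r) {{m^n≢0 (b ^ n) r {{m^n≢0 b n}}}}
P^≡/ n b zero i j with i Fin.≟ j
-- The empty table is the only one and the denominator is 1, so the count is one indicator plus the
-- `0ℤ` that ends the sum.
... | yes e = cong (λ c → (c ℤ.+ 0ℤ) ℚ./ 1) (sym (⟦⟧-true (toℕ i ℕ.≟ toℕ j) (cong toℕ e)))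
... | no ≢  = cong (λ c → (c ℤ.+ 0ℤ) ℚ./ 1) (sym (⟦⟧-false (toℕ i ℕ.≟ toℕ j) (≢ ∘ Fin.toℕ-injective)))
P^≡/ n b (suc r) i j = begin
  sumℚ (map (λ k → P n b i k ℚ.* (P n b ^ᴹ r) k j) (allFin n))
    ≡⟨ cong sumℚ (List.map-cong (λ k → trans
         (cong₂ ℚ._*_ (P≡/ n b i k) (P^≡/ n b r k j))
         (/-* (p k) (carryCount n b r (toℕ k) (toℕ j)) (b ^ n) ((b ^ n) ^ r))) (allFin n)) ⟩
  sumℚ (map (λ k → (p k ℤ.* carryCount n b r (toℕ k) (toℕ j)) ℚ./ ((b ^ n) ^ suc r)) (allFin n))
    ≡⟨ sumℚ-/ (allFin n) (λ k → p k ℤ.* carryCount n b r (toℕ k) (toℕ j)) ((b ^ n) ^ suc r) ⟩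
  ∑ (allFin n) (λ k → p k ℤ.* carryCount n b r (toℕ k) (toℕ j)) ℚ./ ((b ^ n) ^ suc r)
    ≡⟨ cong (λ c → ℚ._/_ c ((b ^ n) ^ suc r) {{m^n≢0 (b ^ n) (suc r)}}) (carryCount-suc n b r (toℕ j) (Fin.toℕ<n i)) ⟩
  carryCount n b (suc r) (toℕ i) (toℕ j) ℚ./ ((b ^ n) ^ suc r) ∎
  where
  open ≡-Reasoning
  instance
    _ = m^n≢0 b n
    _ = m^n≢0 (b ^ n) r
    _ = m^n≢0 (b ^ n) (suc r)
  p : Fin n → ℤ
  p k = ∑ᵈ n b (λ s → ⟦ (toℕ i + s) / b ℕ.≟ toℕ k ⟧)

-- The initial carry 0 serves both as `k` in `∑-carry` and as the empty partial sum `p` in `∑-wrap`.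
carryCount≡∑ : ∀ m b r .{{_ : NonZero b}} j →
  carryCount (suc m) b r 0 j ≡
  ∑ (permutations (suc m)) (λ σ →
    ⟦ descents σ ℕ.≟ j ⟧ ℤ.* binom (+ suc m ℤ.+ + (b ^ r) ℤ.- + descents (flip σ) ℤ.- 1ℤ) (suc m))
carryCount≡∑ m b r j =
  trans (∑-carry (suc m) b r F 0)
    (trans (∑-wrap (suc m) (b ^ r) F (>-nonZero⁻¹ (b ^ r))) (∑-wordDescents m (b ^ r) F))
  where
  instance _ = m^n≢0 b r
  F : ℕ → ℤ
  F d = ⟦ d ℕ.≟ j ⟧

probDescents≡/ : ∀ m b r .{{_ : NonZero b}} j →
  probDescents {suc m} (Q (b ^ r) {{m^n≢0 b r}}) j ≡
  ℚ._/_ (carryCount (suc m) b r 0 j) ((b ^ suc m) ^ r) {{m^n≢0 (b ^ suc m) r {{m^n≢0 b (suc m)}}}}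
probDescents≡/ m b r j = begin
  probDescents {suc m} (Q N) j
    ≡⟨ sumℚ-/ (filter d? ps) q (N ^ suc m) ⟩
  ∑ (filter d? ps) q ℚ./ (N ^ suc m)
    ≡⟨ ℚ./-cong (trans (∑-filter d? ps q) (sym (carryCount≡∑ m b r j)))
         -- Both denominators equal `b ^ (suc m * r)`.
         (trans (ℕ.^-*-assoc b r (suc m)) (trans (cong (b ^_) (ℕ.*-comm r (suc m))) (sym (ℕ.^-*-assoc b (suc m) r)))) ⟩
  carryCount (suc m) b r 0 j ℚ./ ((b ^ suc m) ^ r) ∎
  where
  open ≡-Reasoning
  N = b ^ r
  instance
    _ = m^n≢0 b r
    _ = m^n≢0 N (suc m)
    _ = m^n≢0 b (suc m)
    _ = m^n≢0 (b ^ suc m) r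
  ps = permutations (suc m)
  d? = λ (σ : Permutation′ (suc m)) → descents σ ℕ.≟ j
  q : Permutation′ (suc m) → ℤ
  q σ = binom (+ suc m ℤ.+ + N ℤ.- + descents (flip σ) ℤ.- 1ℤ) (suc m)

theorem1p1 : (n b r : ℕ) .{{_ : NonZero n}} .{{_ : NonZero b}} →
    2 ≤ n → 2 ≤ b → (j : Fin n) →
    (probCarry n b r (toℕ j) ≡ probDescents {n} (Q (b ^ r) {{m^n≢0 b r}}) (toℕ j)) ×
    ((P n b ^ᴹ r) (state0 n) j ≡ probDescents {n} (Q (b ^ r) {{m^n≢0 b r}}) (toℕ j))
theorem1p1 (suc m) b r _ _ j =
    trans (cong (λ c → ℚ._/_ c ((b ^ suc m) ^ r) {{m^n≢0 (b ^ suc m) r {{m^n≢0 b (suc m)}}}})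
             (length-filter≡∑ (λ X → carry 0 X ℕ.≟ toℕ j) (words (words (allFin b) (suc m)) r)))
          (sym (probDescents≡/ m b r (toℕ j)))
  -- `state0 (suc m)` computes to `zero`.
  , trans (P^≡/ (suc m) b r zero j) (sym (probDescents≡/ m b r (toℕ j)))
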